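{- There is an absolute constant $C>0$ such that the following holds. Let $k \ge 9$ and $r \ge 3$ be integers and let $P$ be an $r$-repetition-free $k$-permutation matrix. Then the Füredi--Hajnal limit of $P$ satisfies \[ c_P \le 2^{C\, r^{1/3} k^{2/3} \log^2 k}. \]
   Context: A binary matrix has entries in $\{0,1\}$. A $k$-permutation matrix is a $k\times k$ binary matrix with exactly one $1$-entry in every row and every column. A binary matrix $A$ contains a binary matrix $B$ if $B$ can be obtained from $A$ by deleting some rows, some columns, and changing some $1$-entries to $0$-entries; otherwise $A$ avoids $B$. For a binary matrix $B$, $\mathrm{ex}(n,B)$ is the maximum number of $1$-entries in an $n\times n$ binary matrix avoiding $B$. For a permutation matrix $P$, the Füredi--Hajnal limit is $c_P=\lim_{n\to\infty}\mathrm{ex}(n,P)/n$ (this limit exists and is finite). A $1$-entry is identified with its position $(i,j)$ (row $i$, column $j$); the distance vector from the entry $(i_1,j_1)$ to the entry $(i_2,j_2)$ is $(i_2-i_1,j_2-j_1)$. A vector is $r$-repeated in a permutation matrix $P$ if it occurs as the distance vector of at least $r$ pairs of $1$-entries of $P$; $P$ is $r$-repetition-free if no vector is $r$-repeated in $P$. Logarithms are base $2$. -}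

module Defs where

open import Data.Nat using (ℕ; _+_; _<_)
open import Data.Bool using (Bool; true; false; if_then_else_)
open import Data.Fin using (Fin; toℕ)
open import Data.Fin.Base using () renaming (_<_ to _<ᶠ_)
open import Data.List using (List; map; allFin)
open import Data.Nat.ListAction using (sum)
open import Data.Integer using (ℤ; _⊖_)
open import Data.Product using (Σ; _×_; _,_; ∃-syntax)
open import Relation.Binary.PropositionalEquality using (_≡_; _≢_)
open import Relation.Nullary using (¬_)
open import Function.Definitions using (Injective)

BMat : ℕ → ℕ → Set
BMat m n = Fin m → Fin n → Bool

ones : ∀ {m n} → BMat m n → ℕ
ones {m} {n} A = sum (map (λ i → sum (map (λ j → if A i j then 1 else 0) (allFin n))) (allFin m))

IsPermutationMatrix : ∀ {k} → BMat k k → Set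
IsPermutationMatrix {k} P =
  (∀ i → ∃[ j ] (P i j ≡ true × (∀ j' → P i j' ≡ true → j' ≡ j))) ×
  (∀ j → ∃[ i ] (P i j ≡ true × (∀ i' → P i' j ≡ true → i' ≡ i)))

StrictlyIncreasing : ∀ {a m} → (Fin a → Fin m) → Set
StrictlyIncreasing f = ∀ i j → i <ᶠ j → f i <ᶠ f j

-- A contains B: B obtained from A by deleting rows/columns and turning 1s into 0s.
Contains : ∀ {m n a b} → BMat m n → BMat a b → Set
Contains {m} {n} {a} {b} A B =
  Σ (Fin a → Fin m) λ f → Σ (Fin b → Fin n) λ g →
    StrictlyIncreasing f × StrictlyIncreasing g ×
    (∀ i j → B i j ≡ true → A (f i) (g j) ≡ true)

Avoids : ∀ {m n a b} → BMat m n → BMat a b → Set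
Avoids A B = ¬ Contains A B

Entry : ℕ → Set
Entry k = Fin k × Fin k

dist : ∀ {k} → Entry k → Entry k → ℤ × ℤ
dist (i₁ , j₁) (i₂ , j₂) = (toℕ i₂ ⊖ toℕ i₁) , (toℕ j₂ ⊖ toℕ j₁)

Repeated : ∀ {k} → ℕ → BMat k k → ℤ × ℤ → Set
Repeated {k} r P v =
  Σ (Fin r → Entry k × Entry k) λ f → Injective _≡_ _≡_ f ×
    (∀ t → let e₁ = Data.Product.proj₁ (f t) ; e₂ = Data.Product.proj₂ (f t) in
       P (Data.Product.proj₁ e₁) (Data.Product.proj₂ e₁) ≡ true ×
       P (Data.Product.proj₁ e₂) (Data.Product.proj₂ e₂) ≡ true ×
       e₁ ≢ e₂ × dist e₁ e₂ ≡ v)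

RepetitionFree : ∀ {k} → ℕ → BMat k k → Set
RepetitionFree r P = ∀ v → ¬ Repeated r P v

module Submission where

open import Defs
open import Data.Nat
open import Data.Nat.DivMod
open import Data.Nat.Properties
open import Data.Nat.ListAction using (sum)
open import Data.Nat.Tactic.RingSolver using (solve-∀)
open import Data.Bool using (Bool; true; false; if_then_else_; not; _∧_; _∨_; T)
open import Data.Empty using (⊥)
open import Data.Fin using (Fin; toℕ; fromℕ<; zero; suc)
open import Data.Fin.Base using () renaming (_<_ to _<ᶠ_)
import Data.Fin.Properties as Fin
open import Data.Integer using (ℤ; _⊖_)
import Data.Integer.Properties as ℤ
open import Data.List using (map; allFin; tabulate)
open import Data.List.Properties using (map-tabulate)
open import Data.Product using (Σ; _×_; _,_; ∃-syntax; proj₁; proj₂)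
open import Data.Sum using (_⊎_; inj₁; inj₂)
open import Function using (id; _∘_)
open import Relation.Binary.Definitions using (tri<; tri≈; tri>)
open import Relation.Binary.PropositionalEquality
open import Relation.Nullary using (¬_; yes; no; contradiction)

-- Call a column of a row of blocks hit when it contains a one. In a vertical strip of
-- t = poly(k) columns, take many blocks that each hit at least τ columns. Cut an interval
-- of them into 2k chunks, and pass to a chunk whenever it hits at most the fraction
-- 1 - 1/(64 s) of the columns hit by the interval. This stops after O(s log k) steps,
-- leaving an interval minor with 2k rows whose density of zeros is at most 1/(64 s).
--
-- Such a minor contains P. Split the columns of P into s groups of about k/s columns,
-- translate P by a random number of rows and of column blocks, and let every group choose
-- its own offset in its column block. A group finds an offset avoiding all zeros as soon
-- as the zero densities met by its entries add up to less than one. When the sum is large,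
-- so is the sum of the products over pairs in the group; as a distance vector occurs less
-- than r times in P, the average of the latter is O(r k² / s³).
--
-- Hence a strip has 2^O(s log² k) wide blocks, dually for tall blocks, and the bound on the
-- number of ones follows by contracting t × t blocks as in the proof of Marcus and Tardos.

-- Finite sums and enumerations

∑ : ℕ → (ℕ → ℕ) → ℕ
∑ zero    f = 0
∑ (suc n) f = f 0 + ∑ n (λ i → f (suc i))

syntax ∑ n (λ i → e) = ∑[ i < n ] e

∑-mono-≤ : ∀ {f g : ℕ → ℕ} n → (∀ i → i < n → f i ≤ g i) → ∑ n f ≤ ∑ n g
∑-mono-≤ zero    h = z≤n
∑-mono-≤ (suc n) h = +-mono-≤ (h 0 z<s) (∑-mono-≤ n (λ i i<n → h (suc i) (s<s i<n)))

∑-cong : ∀ {f g : ℕ → ℕ} n → (∀ i → f i ≡ g i) → ∑ n f ≡ ∑ n g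
∑-cong zero    h = refl
∑-cong (suc n) h = cong₂ _+_ (h 0) (∑-cong n (λ i → h (suc i)))

∑-+ : ∀ n (f g : ℕ → ℕ) → ∑[ i < n ] (f i + g i) ≡ ∑ n f + ∑ n g
∑-+ zero    f g = refl
∑-+ (suc n) f g rewrite ∑-+ n (λ i → f (suc i)) (λ i → g (suc i)) =
  interchange (f 0) (g 0) _ _
  where
  interchange : ∀ a b c d → a + b + (c + d) ≡ a + c + (b + d)
  interchange = solve-∀

∑-*ˡ : ∀ n c (f : ℕ → ℕ) → ∑[ i < n ] (c * f i) ≡ c * ∑ n f
∑-*ˡ zero    c f = sym (*-zeroʳ c)
∑-*ˡ (suc n) c f rewrite ∑-*ˡ n c (λ i → f (suc i)) = sym (*-distribˡ-+ c (f 0) _)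

∑-*ʳ : ∀ n c (f : ℕ → ℕ) → ∑[ i < n ] (f i * c) ≡ ∑ n f * c
∑-*ʳ zero    c f = refl
∑-*ʳ (suc n) c f rewrite ∑-*ʳ n c (λ i → f (suc i)) = sym (*-distribʳ-+ c (f 0) _)

∑-const : ∀ n c → ∑[ _ < n ] c ≡ n * c
∑-const zero    c = refl
∑-const (suc n) c = cong (c +_) (∑-const n c)

∑-swap : ∀ m n (f : ℕ → ℕ → ℕ) →
         ∑[ i < m ] (∑[ j < n ] f i j) ≡ ∑[ j < n ] (∑[ i < m ] f i j)
∑-swap zero    n f = sym (trans (∑-const n 0) (*-zeroʳ n))
∑-swap (suc m) n f =
  trans (cong (∑ n (f 0) +_) (∑-swap m n (λ i → f (suc i))))
        (sym (∑-+ n (f 0) (λ j → ∑[ i < m ] f (suc i) j)))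

∑-split : ∀ m n (f : ℕ → ℕ) → ∑ (m + n) f ≡ ∑ m f + ∑[ i < n ] f (m + i)
∑-split zero    n f = refl
∑-split (suc m) n f rewrite ∑-split m n (λ i → f (suc i)) = sym (+-assoc (f 0) _ _)

∑-blocks : ∀ m n (f : ℕ → ℕ) → ∑ (m * n) f ≡ ∑[ i < m ] (∑[ j < n ] f (i * n + j))
∑-blocks zero    n f = refl
∑-blocks (suc m) n f =
  trans (∑-split n (m * n) f)
  (cong (∑ n f +_)
    (trans (∑-blocks m n (λ i → f (n + i)))
           (∑-cong m (λ i → ∑-cong n (λ j → cong f (sym (+-assoc n (i * n) j)))))))

∑-≤-length : ∀ {m n} (f : ℕ → ℕ) → m ≤ n → ∑ m f ≤ ∑ n f
∑-≤-length         f z≤n       = z≤n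
∑-≤-length {suc m} f (s≤s m≤n) = +-monoʳ-≤ (f 0) (∑-≤-length (λ i → f (suc i)) m≤n)

∑-window-≤ : ∀ c n {m} (f : ℕ → ℕ) → c + n ≤ m → ∑[ i < n ] f (c + i) ≤ ∑ m f
∑-window-≤ c n f c+n≤m =
  ≤-trans (m≤n+m _ (∑ c f))
  (≤-trans (≤-reflexive (sym (∑-split c n f))) (∑-≤-length f c+n≤m))

term≤∑ : ∀ {n i} (f : ℕ → ℕ) → i < n → f i ≤ ∑ n f
term≤∑ {suc n} {zero}  f i<n       = m≤m+n _ _
term≤∑ {suc n} {suc i} f (s≤s i<n) =
  ≤-trans (term≤∑ (λ i → f (suc i)) i<n) (m≤n+m _ (f 0))

∑-average : ∀ n {c} (f : ℕ → ℕ) → ∑ n f < n * c → ∃[ i ] (i < n × f i < c)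
∑-average zero    f ()
∑-average (suc n) {c} f lt with f 0 <? c
... | yes f0<c = 0 , z<s , f0<c
... | no  f0≮c =
  let i , i<n , fi<c = ∑-average n (λ i → f (suc i))
                         (+-cancelˡ-< c _ _ (<-≤-trans (s≤s (+-monoˡ-≤ _ (≮⇒≥ f0≮c))) lt))
  in suc i , s<s i<n , fi<c

𝟙 : Bool → ℕ
𝟙 b = if b then 1 else 0

𝟙≤1 : ∀ b → 𝟙 b ≤ 1
𝟙≤1 true  = ≤-refl
𝟙≤1 false = z≤n

count : ℕ → (ℕ → Bool) → ℕ
count n φ = ∑[ i < n ] 𝟙 (φ i)

count≤ : ∀ n φ → count n φ ≤ n
count≤ n φ = ≤-trans (∑-mono-≤ n (λ i _ → 𝟙≤1 (φ i)))
             (≤-reflexive (trans (∑-const n 1) (*-identityʳ n)))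

any : ℕ → (ℕ → Bool) → Bool
any zero    φ = false
any (suc n) φ = φ 0 ∨ any n (λ i → φ (suc i))

any⇒∃ : ∀ n φ → any n φ ≡ true → ∃[ i ] (i < n × φ i ≡ true)
any⇒∃ (suc n) φ h with φ 0 in eq
... | true  = 0 , z<s , eq
... | false = let i , i<n , φi = any⇒∃ n (λ i → φ (suc i)) h in suc i , s<s i<n , φi

∃⇒any : ∀ {n i} φ → i < n → φ i ≡ true → any n φ ≡ true
∃⇒any {suc n} {zero}  φ _ φi rewrite φi = refl
∃⇒any {suc n} {suc i} φ (s≤s i<n) φi with φ 0
... | true  = refl
... | false = ∃⇒any (λ i → φ (suc i)) i<n φi

StrictMono : (ℕ → ℕ) → Set
StrictMono e = ∀ {i j} → i < j → e i < e j

-- Beyond the last index satisfying φ the enumeration continues with arbitrary larger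
-- values, so that it is strictly increasing on all of ℕ.
nth : (ℕ → Bool) → ℕ → ℕ → ℕ
nth φ zero    i = i
nth φ (suc n) i with φ 0
nth φ (suc n) zero    | true  = 0
nth φ (suc n) (suc i) | true  = suc (nth (λ j → φ (suc j)) n i)
nth φ (suc n) i       | false = suc (nth (λ j → φ (suc j)) n i)

nth-mono : ∀ φ n → StrictMono (nth φ n)
nth-mono φ zero    i<j = i<j
nth-mono φ (suc n) {i} {j} i<j with φ 0
nth-mono φ (suc n) {zero}  {suc j} _         | true  = z<s
nth-mono φ (suc n) {suc i} {suc j} (s≤s i<j) | true  = s<s (nth-mono (λ j → φ (suc j)) n i<j)
nth-mono φ (suc n) {i}     {j}     i<j       | false = s<s (nth-mono (λ j → φ (suc j)) n i<j)

nth-true : ∀ φ n {i} → i < count n φ → φ (nth φ n i) ≡ true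
nth-true φ (suc n) {i} i<c with φ 0 in eq
nth-true φ (suc n) {zero}  _         | true  = eq
nth-true φ (suc n) {suc i} (s≤s i<c) | true  = nth-true (λ j → φ (suc j)) n i<c
nth-true φ (suc n) {i}     i<c       | false = nth-true (λ j → φ (suc j)) n i<c

∑-nth : ∀ φ n (f : ℕ → ℕ) → ∑[ i < count n φ ] f (nth φ n i) ≡ ∑[ i < n ] (𝟙 (φ i) * f i)
∑-nth φ zero    f = refl
∑-nth φ (suc n) f with φ 0
... | true  = cong₂ _+_ (sym (+-identityʳ (f 0))) (∑-nth (λ j → φ (suc j)) n (λ j → f (suc j)))
... | false = ∑-nth (λ j → φ (suc j)) n (λ j → f (suc j))

T⇒≡ : ∀ {b} → T b → b ≡ true
T⇒≡ {true} _ = refl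

≡⇒T : ∀ {b} → b ≡ true → T b
≡⇒T refl = _

<⇒<ᵇ≡ : ∀ {m n} → m < n → (m <ᵇ n) ≡ true
<⇒<ᵇ≡ m<n = T⇒≡ (<⇒<ᵇ m<n)

<ᵇ≡⇒< : ∀ m n → (m <ᵇ n) ≡ true → m < n
<ᵇ≡⇒< m n h = <ᵇ⇒< m n (≡⇒T h)

≡⇒≡ᵇ≡ : ∀ {m n} → m ≡ n → (m ≡ᵇ n) ≡ true
≡⇒≡ᵇ≡ {m} {n} h = T⇒≡ (≡⇒≡ᵇ m n h)

∧-true : ∀ b {c} → b ∧ c ≡ true → b ≡ true × c ≡ true
∧-true true h = refl , h

choose : ∀ {P : ℕ → ℕ → Set} n → (∀ i → i < n → ∃[ x ] P i x) →
         Σ (ℕ → ℕ) λ o → ∀ i → i < n → P i (o i)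
choose zero    h = (λ _ → 0) , λ _ ()
choose (suc n) h =
  let x , Px = h 0 z<s
      o , Po = choose n (λ i i<n → h (suc i) (s<s i<n))
  in (λ { zero → x ; (suc i) → o i })
   , (λ { zero _ → Px ; (suc i) (s≤s i<n) → Po i i<n })

-- The ones of the permutation matrix are `(p j , j)`, so only k positions are tested. The host
-- lives on all of ℕ, so that contractions, strips and shifts carry no size bounds.
Emb : ∀ {k} → (Fin k → Fin k) → (ℕ → ℕ → Bool) → Set
Emb {k} p A =
  Σ (Fin k → ℕ) λ a → Σ (Fin k → ℕ) λ b →
    (∀ i j → i <ᶠ j → a i < a j) × (∀ i j → i <ᶠ j → b i < b j) ×
    (∀ j → A (a (p j)) (b j) ≡ true)

extend : ∀ {k} → (Fin k → Fin k) → ℕ → ℕ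
extend {k} p j with j <? k
... | yes j<k = toℕ (p (fromℕ< j<k))
... | no  _   = 0

extend-toℕ : ∀ {k} (p : Fin k → Fin k) j → extend p (toℕ j) ≡ toℕ (p j)
extend-toℕ {k} p j with toℕ j <? k
... | yes j<k = cong (λ i → toℕ (p i)) (Fin.fromℕ<-toℕ j j<k)
... | no  j≮k = contradiction (Fin.toℕ<n j) j≮k

extend-< : ∀ {k} (p : Fin k → Fin k) j → j < k → extend p j < k
extend-< {k} p j j<k with j <? k
... | yes j<k′ = Fin.toℕ<n (p (fromℕ< j<k′))
... | no  j≮k  = contradiction j<k j≮k

-- Pairs of ones at a fixed distance

-- The diagonal is bounded by `h l * h l ≤ a * h l`. The differences `suc d` run past the end of the
-- range: the extra terms only enlarge the right side, and a rectangular index set lets sums be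
-- swapped later.
square-expand : ∀ n a (h : ℕ → ℕ) → (∀ l → h l ≤ a) →
  ∑ n h * ∑ n h ≤ a * ∑ n h + 2 * ∑[ l < n ] (∑[ d < n ] (h l * h (l + suc d)))
square-expand zero    a h h≤a = z≤n
square-expand (suc n) a h h≤a = begin
  (h 0 + S) * (h 0 + S)
    ≡⟨ binomial (h 0) S ⟩
  h 0 * h 0 + (2 * (h 0 * S) + S * S)
    ≤⟨ +-mono-≤ (*-monoˡ-≤ (h 0) (h≤a 0))
         (+-monoʳ-≤ (2 * (h 0 * S)) (square-expand n a (λ l → h (suc l)) (λ l → h≤a (suc l)))) ⟩
  a * h 0 + (2 * (h 0 * S) + (a * S + 2 * Q))
    ≡⟨ regroup a (h 0) S (h 0 * S) Q ⟩
  a * (h 0 + S) + 2 * (h 0 * S + Q)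
    ≤⟨ +-monoʳ-≤ (a * (h 0 + S)) (*-monoʳ-≤ 2 (+-mono-≤ first rest)) ⟩
  a * (h 0 + S) + 2 * ∑[ l < suc n ] (∑[ d < suc n ] (h l * h (l + suc d)))
    ∎
  where
  open ≤-Reasoning
  S = ∑[ l < n ] h (suc l)
  Q = ∑[ l < n ] (∑[ d < n ] (h (suc l) * h (suc (l + suc d))))
  binomial : ∀ x y → (x + y) * (x + y) ≡ x * x + (2 * (x * y) + y * y)
  binomial = solve-∀
  regroup : ∀ a x s y q → a * x + (2 * y + (a * s + 2 * q)) ≡ a * (x + s) + 2 * (y + q)
  regroup = solve-∀
  first : h 0 * S ≤ ∑[ d < suc n ] (h 0 * h (suc d))
  first = ≤-trans (≤-reflexive (sym (∑-*ˡ n (h 0) (λ d → h (suc d)))))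
                  (∑-≤-length (λ d → h 0 * h (suc d)) (n≤1+n n))
  rest : Q ≤ ∑[ l < n ] (∑[ d < suc n ] (h (suc l) * h (suc l + suc d)))
  rest = ∑-mono-≤ n (λ l _ → ∑-≤-length (λ d → h (suc l) * h (suc (l + suc d))) (n≤1+n n))

-- For p mapping columns to rows, the pairs counted here are those with distance vector
-- (x′ - x , d + 1); the equation is arranged to avoid subtraction.
FewRepetitions : ℕ → ℕ → (ℕ → ℕ) → Set
FewRepetitions k r p =
  ∀ n d x x′ → count n (λ j → (j + suc d <ᵇ k) ∧ (x + p (j + suc d) ≡ᵇ x′ + p j)) ≤ r

module _ {k r : ℕ} {p : ℕ → ℕ} (p< : ∀ j → j < k → p j < k) (few : FewRepetitions k r p) where

  -- Cost of column `j` after moving the permutation down by `v` rows; `ζ` will count the zeros of a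
  -- row inside one column block. The indicator masks the junk value of `extend` beyond the last
  -- column.
  weight : (ℕ → ℕ) → ℕ → ℕ → ℕ
  weight ζ j v = 𝟙 (j <ᵇ k) * ζ (p j + v)

  -- For a fixed column, different shifts `v` give different rows `x = p j + v`, and the partner row
  -- `x′ = p (j + suc d) + v` is then determined. A pair `(x , x′)` fixes the distance vector, so at
  -- most `r` columns produce it.
  pair-sum-≤ : ∀ (ζ : ℕ → ℕ) n d → let Z = ∑ (k + k) ζ in
    ∑[ v < k ] (∑[ j < n ] (weight ζ j v * weight ζ (j + suc d) v)) ≤ r * (Z * Z)
  pair-sum-≤ ζ n d = begin
    ∑[ v < k ] (∑[ j < n ] (weight ζ j v * weight ζ (j + suc d) v))
      ≡⟨ ∑-swap k n _ ⟩
    ∑[ j < n ] (∑[ v < k ] (weight ζ j v * weight ζ (j + suc d) v))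
      ≤⟨ ∑-mono-≤ n (λ j _ → per-column j) ⟩
    ∑[ j < n ] (∑[ x < m ] (∑[ x′ < m ] (ζ x * ζ x′ * 𝟙 (hit x x′ j))))
      ≡⟨ ∑-swap n m _ ⟩
    ∑[ x < m ] (∑[ j < n ] (∑[ x′ < m ] (ζ x * ζ x′ * 𝟙 (hit x x′ j))))
      ≤⟨ ∑-mono-≤ m (λ x _ → per-row x) ⟩
    ∑[ x < m ] (ζ x * (r * Z))
      ≡⟨ ∑-*ʳ m (r * Z) ζ ⟩
    Z * (r * Z)
      ≡⟨ reorder Z r ⟩
    r * (Z * Z) ∎
    where
    open ≤-Reasoning
    m = k + k
    Z = ∑ m ζ
    hit : ℕ → ℕ → ℕ → Bool
    hit x x′ j = (j + suc d <ᵇ k) ∧ (x + p (j + suc d) ≡ᵇ x′ + p j)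
    reorder : ∀ z r → z * (r * z) ≡ r * (z * z)
    reorder = solve-∀
    shuffle : ∀ a b v → a + v + b ≡ b + v + a
    shuffle = solve-∀

    per-row : ∀ x → ∑[ j < n ] (∑[ x′ < m ] (ζ x * ζ x′ * 𝟙 (hit x x′ j))) ≤ ζ x * (r * Z)
    per-row x = begin
      ∑[ j < n ] (∑[ x′ < m ] (ζ x * ζ x′ * 𝟙 (hit x x′ j)))
        ≡⟨ ∑-swap n m _ ⟩
      ∑[ x′ < m ] (∑[ j < n ] (ζ x * ζ x′ * 𝟙 (hit x x′ j)))
        ≡⟨ ∑-cong m (λ x′ → ∑-*ˡ n (ζ x * ζ x′) (λ j → 𝟙 (hit x x′ j))) ⟩
      ∑[ x′ < m ] (ζ x * ζ x′ * count n (hit x x′))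
        ≤⟨ ∑-mono-≤ m (λ x′ _ → *-monoʳ-≤ (ζ x * ζ x′) (few n d x x′)) ⟩
      ∑[ x′ < m ] (ζ x * ζ x′ * r)
        ≡⟨ ∑-cong m (λ x′ → trans (*-assoc (ζ x) (ζ x′) r)
                                  (cong (ζ x *_) (*-comm (ζ x′) r))) ⟩
      ∑[ x′ < m ] (ζ x * (r * ζ x′))
        ≡⟨ trans (∑-*ˡ m (ζ x) (λ x′ → r * ζ x′)) (cong (ζ x *_) (∑-*ˡ m r ζ)) ⟩
      ζ x * (r * Z) ∎

    per-column : ∀ j → ∑[ v < k ] (weight ζ j v * weight ζ (j + suc d) v) ≤
                       ∑[ x < m ] (∑[ x′ < m ] (ζ x * ζ x′ * 𝟙 (hit x x′ j)))
    per-column j with (j + suc d) <? k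
    ... | no j+d≮k = begin
      ∑[ v < k ] (weight ζ j v * weight ζ (j + suc d) v)
        ≤⟨ ∑-mono-≤ k (λ v _ → ≤-reflexive (vanish v)) ⟩
      ∑[ v < k ] 0
        ≡⟨ trans (∑-const k 0) (*-zeroʳ k) ⟩
      0 ≤⟨ z≤n ⟩
      _ ∎
      where
      vanish : ∀ v → weight ζ j v * weight ζ (j + suc d) v ≡ 0
      vanish v with (j + suc d) <ᵇ k in eq
      ... | true  = contradiction (<ᵇ≡⇒< (j + suc d) k eq) j+d≮k
      ... | false = *-zeroʳ (weight ζ j v)
    ... | yes j+d<k = begin
      ∑[ v < k ] (weight ζ j v * weight ζ (j + suc d) v)
        ≤⟨ ∑-mono-≤ k (λ v v<k → single v v<k) ⟩
      ∑[ v < k ] F (p j + v)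
        ≤⟨ ∑-window-≤ (p j) k F (+-monoˡ-≤ k (<⇒≤ (p< j j<k))) ⟩
      ∑ m F ∎
      where
      F : ℕ → ℕ
      F x = ∑[ x′ < m ] (ζ x * ζ x′ * 𝟙 (hit x x′ j))
      j<k : j < k
      j<k = ≤-<-trans (m≤m+n j (suc d)) j+d<k
      single : ∀ v → v < k → weight ζ j v * weight ζ (j + suc d) v ≤ F (p j + v)
      single v v<k = begin
        weight ζ j v * weight ζ (j + suc d) v
          ≡⟨ cong₂ (λ b c → (𝟙 b * ζ (p j + v)) * (𝟙 c * ζ x′)) (<⇒<ᵇ≡ j<k) (<⇒<ᵇ≡ j+d<k) ⟩
        (1 * ζ (p j + v)) * (1 * ζ x′)
          ≡⟨ cong₂ _*_ (*-identityˡ (ζ (p j + v))) (*-identityˡ (ζ x′)) ⟩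
        ζ (p j + v) * ζ x′
          ≡⟨ sym (*-identityʳ (ζ (p j + v) * ζ x′)) ⟩
        ζ (p j + v) * ζ x′ * 1
          ≡⟨ cong (λ b → ζ (p j + v) * ζ x′ * 𝟙 b)
               (sym (cong₂ _∧_ (<⇒<ᵇ≡ j+d<k) (≡⇒≡ᵇ≡ (shuffle (p j) (p (j + suc d)) v)))) ⟩
        ζ (p j + v) * ζ x′ * 𝟙 (hit (p j + v) x′ j)
          ≤⟨ term≤∑ (λ x′ → ζ (p j + v) * ζ x′ * 𝟙 (hit (p j + v) x′ j))
               (+-mono-< (p< (j + suc d) j+d<k) v<k) ⟩
        F (p j + v) ∎
        where x′ = p (j + suc d) + v

𝟙≡0⇒false : ∀ b → 𝟙 b ≡ 0 → b ≡ false
𝟙≡0⇒false false _ = refl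

not≡false : ∀ b → not b ≡ false → b ≡ true
not≡false true _ = refl

-- Minors with few zeros

-- Group `X` of `g` columns is sent into block `X + u` of width `W`. Shifts `u < s` account for the
-- `2 * s` blocks and shifts `v < k` for the `k + k` rows.
module SparseZeros
  {k r : ℕ} (p : ℕ → ℕ) (p< : ∀ j → j < k → p j < k) (few : FewRepetitions k r p)
  (B : ℕ → ℕ → Bool) {g s W a b : ℕ}
  (rows : ∀ x → x < k + k → ∑[ y < 2 * s * W ] 𝟙 (not (B x y)) ≤ a)
  (columns : ∀ y → y < 2 * s * W → ∑[ x < k + k ] 𝟙 (not (B x y)) ≤ b)
  (2g≤W : 2 * g ≤ W) (4a≤W : 4 * a ≤ W) (0<s : 0 < s) (0<g : 0 < g)
  (sparse : 32 * g * r * (b * b) < k)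
  where

  z : ℕ → ℕ → ℕ
  z x y = 𝟙 (not (B x y))

  ζ : ℕ → ℕ → ℕ
  ζ Y x = ∑[ w < W ] z x (Y * W + w)

  block-fits : ∀ {Y} → Y < 2 * s → Y * W + W ≤ 2 * s * W
  block-fits {Y} Y<2s = ≤-trans (≤-reflexive (+-comm (Y * W) W)) (*-monoˡ-≤ W Y<2s)

  ζ≤a : ∀ Y x → Y < 2 * s → x < k + k → ζ Y x ≤ a
  ζ≤a Y x Y<2s x<2k = ≤-trans (∑-window-≤ (Y * W) W (z x) (block-fits Y<2s)) (rows x x<2k)

  ∑ζ≤ : ∀ Y → Y < 2 * s → ∑ (k + k) (ζ Y) ≤ W * b
  ∑ζ≤ Y Y<2s = begin
    ∑ (k + k) (ζ Y)
      ≡⟨ ∑-swap (k + k) W _ ⟩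
    ∑[ w < W ] (∑[ x < k + k ] z x (Y * W + w))
      ≤⟨ ∑-mono-≤ W (λ w w<W → columns (Y * W + w)
           (<-≤-trans (+-monoʳ-< (Y * W) w<W) (block-fits Y<2s))) ⟩
    ∑[ _ < W ] b
      ≡⟨ ∑-const W b ⟩
    W * b ∎
    where open ≤-Reasoning

  h : ℕ → ℕ → ℕ → ℕ
  h v Y j = weight p< few (ζ Y) j v

  h≤a : ∀ {v Y} → v < k → Y < 2 * s → ∀ j → h v Y j ≤ a
  h≤a {v} {Y} v<k Y<2s j with j <ᵇ k in eq
  ... | false = z≤n
  ... | true  = ≤-trans (≤-reflexive (*-identityˡ _))
                  (ζ≤a Y (p j + v) Y<2s (+-mono-< (p< j (<ᵇ≡⇒< j k eq)) v<k))

  -- The second column `X * g + l + suc d` may leave group `X`; with this overcount the groups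
  -- concatenate to one sum over all columns.
  pairs : ℕ → ℕ → ℕ → ℕ
  pairs v X Y = ∑[ l < g ] (∑[ d < g ] (h v Y (X * g + l) * h v Y (X * g + l + suc d)))

  -- Group and position merge into a single column index, so `pair-sum-≤` is applied only once for
  -- each of the `g` differences, and not separately in every group.
  block-pairs-≤ : ∀ Y → Y < 2 * s →
    ∑[ v < k ] (∑[ X < s ] pairs v X Y) ≤ g * (r * ((W * b) * (W * b)))
  block-pairs-≤ Y Y<2s = begin
    ∑[ v < k ] (∑[ X < s ] pairs v X Y)
      ≡⟨ ∑-cong k (λ v → sym (∑-blocks s g (λ j → ∑[ d < g ] (h v Y j * h v Y (j + suc d))))) ⟩
    ∑[ v < k ] (∑[ j < s * g ] (∑[ d < g ] (h v Y j * h v Y (j + suc d))))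
      ≡⟨ ∑-cong k (λ v → ∑-swap (s * g) g _) ⟩
    ∑[ v < k ] (∑[ d < g ] (∑[ j < s * g ] (h v Y j * h v Y (j + suc d))))
      ≡⟨ ∑-swap k g _ ⟩
    ∑[ d < g ] (∑[ v < k ] (∑[ j < s * g ] (h v Y j * h v Y (j + suc d))))
      ≤⟨ ∑-mono-≤ g (λ d _ → ≤-trans (pair-sum-≤ p< few (ζ Y) (s * g) d)
           (*-monoʳ-≤ r (*-mono-≤ (∑ζ≤ Y Y<2s) (∑ζ≤ Y Y<2s)))) ⟩
    ∑[ _ < g ] (r * ((W * b) * (W * b)))
      ≡⟨ ∑-const g _ ⟩
    g * (r * ((W * b) * (W * b))) ∎
    where open ≤-Reasoning

  all-pairs-≤ : ∑[ v < k ] (∑[ u < s ] (∑[ X < s ] pairs v X (X + u))) ≤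
                2 * s * (g * (r * ((W * b) * (W * b))))
  all-pairs-≤ = begin
    ∑[ v < k ] (∑[ u < s ] (∑[ X < s ] pairs v X (X + u)))
      ≡⟨ ∑-cong k (λ v → ∑-swap s s _) ⟩
    ∑[ v < k ] (∑[ X < s ] (∑[ u < s ] pairs v X (X + u)))
      ≤⟨ ∑-mono-≤ k (λ v _ → ∑-mono-≤ s (λ X X<s →
           ∑-window-≤ X s (pairs v X) (X+s≤2s X<s))) ⟩
    ∑[ v < k ] (∑[ X < s ] (∑[ Y < 2 * s ] pairs v X Y))
      ≡⟨ ∑-cong k (λ v → ∑-swap s (2 * s) _) ⟩
    ∑[ v < k ] (∑[ Y < 2 * s ] (∑[ X < s ] pairs v X Y))
      ≡⟨ ∑-swap k (2 * s) _ ⟩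
    ∑[ Y < 2 * s ] (∑[ v < k ] (∑[ X < s ] pairs v X Y))
      ≤⟨ ∑-mono-≤ (2 * s) block-pairs-≤ ⟩
    ∑[ _ < 2 * s ] (g * (r * ((W * b) * (W * b))))
      ≡⟨ ∑-const (2 * s) _ ⟩
    2 * s * (g * (r * ((W * b) * (W * b)))) ∎
    where
    open ≤-Reasoning
    X+s≤2s : ∀ {X} → X < s → X + s ≤ 2 * s
    X+s≤2s X<s = ≤-trans (+-monoˡ-≤ s (<⇒≤ X<s))
                   (≤-reflexive (cong (s +_) (sym (+-identityʳ s))))

  -- Offsets below `W′` keep `g` consecutive columns inside a block. The threshold `c` is
  -- `S * (S ∸ a)` at `S = W′`, the number of zeros from which a group could be blocked at every
  -- offset.
  W′ c : ℕ
  W′ = W ∸ g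
  c  = W′ * (W′ ∸ a)

  g≤W : g ≤ W
  g≤W = ≤-trans (m≤m+n g (g + 0)) 2g≤W

  0<W : 0 < W
  0<W = <-≤-trans 0<g g≤W

  W≤2W′ : W ≤ 2 * W′
  W≤2W′ = +-cancelʳ-≤ (2 * g) W (2 * W′) (begin
    W + 2 * g        ≤⟨ +-monoʳ-≤ W 2g≤W ⟩
    W + W            ≡⟨ cong (W +_) (sym (+-identityʳ W)) ⟩
    2 * W            ≡⟨ cong (2 *_) (sym (m∸n+n≡m g≤W)) ⟩
    2 * (W′ + g)     ≡⟨ *-distribˡ-+ 2 W′ g ⟩
    2 * W′ + 2 * g   ∎)
    where open ≤-Reasoning

  W≤4[W′∸a] : W ≤ 4 * (W′ ∸ a)
  W≤4[W′∸a] = +-cancelʳ-≤ (4 * a) W _ (begin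
    W + 4 * a              ≤⟨ +-monoʳ-≤ W 4a≤W ⟩
    W + W                  ≡⟨ cong (W +_) (sym (+-identityʳ W)) ⟩
    2 * W                  ≤⟨ *-monoʳ-≤ 2 W≤2W′ ⟩
    2 * (2 * W′)           ≡⟨ sym (*-assoc 2 2 W′) ⟩
    4 * W′                 ≤⟨ *-monoʳ-≤ 4 (m≤n+m∸n W′ a) ⟩
    4 * (a + (W′ ∸ a))     ≡⟨ trans (*-distribˡ-+ 4 a _) (+-comm (4 * a) _) ⟩
    4 * (W′ ∸ a) + 4 * a   ∎)
    where open ≤-Reasoning

  -- The mean over the `k * s` shifts is below `c`. The 8 comes from `W * W ≤ 8 * c`, the product of
  -- `W≤2W′` and `W≤4[W′∸a]`; the 32 in `sparse` is this 8 times 2 from the square and 2 from the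
  -- `2 * s` blocks.
  averages : ∑[ v < k ] (∑[ u < s ] (∑[ X < s ] (2 * pairs v X (X + u)))) < k * (s * c)
  averages = *-cancelˡ-< 8 _ _ (begin-strict
    8 * ∑[ v < k ] (∑[ u < s ] (∑[ X < s ] (2 * pairs v X (X + u))))
      ≡⟨ cong (8 *_) pull-out ⟩
    8 * (2 * ∑[ v < k ] (∑[ u < s ] (∑[ X < s ] pairs v X (X + u))))
      ≤⟨ *-monoʳ-≤ 8 (*-monoʳ-≤ 2 all-pairs-≤) ⟩
    8 * (2 * (2 * s * (g * (r * ((W * b) * (W * b))))))
      ≡⟨ collect s g r W b ⟩
    32 * g * r * (b * b) * (s * (W * W))
      <⟨ *-monoˡ-< (s * (W * W)) ⦃ positive ⦄ sparse ⟩
    k * (s * (W * W))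
      ≤⟨ *-monoʳ-≤ k (*-monoʳ-≤ s (*-mono-≤ W≤2W′ W≤4[W′∸a])) ⟩
    k * (s * (2 * W′ * (4 * (W′ ∸ a))))
      ≡⟨ distribute k s W′ (W′ ∸ a) ⟩
    8 * (k * (s * c)) ∎)
    where
    open ≤-Reasoning
    positive : NonZero (s * (W * W))
    positive = m*n≢0 s (W * W) ⦃ >-nonZero 0<s ⦄ ⦃ m*n≢0 W W ⦃ >-nonZero 0<W ⦄ ⦃ >-nonZero 0<W ⦄ ⦄
    pull-out : ∑[ v < k ] (∑[ u < s ] (∑[ X < s ] (2 * pairs v X (X + u)))) ≡
               2 * ∑[ v < k ] (∑[ u < s ] (∑[ X < s ] pairs v X (X + u)))
    pull-out =
      trans (∑-cong k (λ v → trans (∑-cong s (λ u → ∑-*ˡ s 2 (λ X → pairs v X (X + u))))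
                                   (∑-*ˡ s 2 (λ u → ∑[ X < s ] pairs v X (X + u)))))
            (∑-*ˡ k 2 (λ v → ∑[ u < s ] (∑[ X < s ] pairs v X (X + u))))
    collect : ∀ s g r w b → 8 * (2 * (2 * s * (g * (r * ((w * b) * (w * b)))))) ≡
                            32 * g * r * (b * b) * (s * (w * w))
    collect = solve-∀
    distribute : ∀ k s x y → k * (s * (2 * x * (4 * y))) ≡ 8 * (k * (s * (x * y)))
    distribute = solve-∀

  -- The zeros S met by a group satisfy S² ≤ a S + 2 pairs, and S (S ∸ a) is monotone in S.
  group-zeros-< : ∀ {v u X} → v < k → u < s → X < s → 2 * pairs v X (X + u) < c →
                  ∑[ l < g ] h v (X + u) (X * g + l) < W′
  group-zeros-< {v} {u} {X} v<k u<s X<s small = ≰⇒> λ W′≤S →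
    <⇒≱ small (≤-trans (*-mono-≤ W′≤S (∸-monoˡ-≤ a W′≤S)) S[S∸a]≤)
    where
    open ≤-Reasoning
    Y = X + u
    Y<2s : Y < 2 * s
    Y<2s = <-≤-trans (+-mono-< X<s u<s) (≤-reflexive (cong (s +_) (sym (+-identityʳ s))))
    f : ℕ → ℕ
    f l = h v Y (X * g + l)
    S = ∑ g f
    same-pairs : ∑[ l < g ] (∑[ d < g ] (f l * f (l + suc d))) ≡ pairs v X Y
    same-pairs = ∑-cong g (λ l → ∑-cong g (λ d →
      cong (λ j → f l * h v Y j) (sym (+-assoc (X * g) l (suc d)))))
    S[S∸a]≤ : S * (S ∸ a) ≤ 2 * pairs v X Y
    S[S∸a]≤ = begin
      S * (S ∸ a)      ≡⟨ *-distribˡ-∸ S S a ⟩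
      S * S ∸ S * a    ≤⟨ m≤n+o⇒m∸n≤o (S * S) (S * a) (begin
        S * S
          ≤⟨ square-expand g a f (λ l → h≤a v<k Y<2s (X * g + l)) ⟩
        a * S + 2 * ∑[ l < g ] (∑[ d < g ] (f l * f (l + suc d)))
          ≡⟨ cong₂ _+_ (*-comm a S) (cong (2 *_) same-pairs) ⟩
        S * a + 2 * pairs v X Y ∎) ⟩
      2 * pairs v X Y  ∎

  -- Union bound: as the offset varies, each entry scans distinct columns of its row in the block.
  -- Hence the `W′` offsets together meet fewer than `W′` zeros, and one of them meets none.
  offset : ∀ {v u X} → ∑[ l < g ] h v (X + u) (X * g + l) < W′ →
    ∃[ o ] (o + g ≤ W × (∀ l → l < g → X * g + l < k →
      B (p (X * g + l) + v) ((X + u) * W + (o + l)) ≡ true))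
  offset {v} {u} {X} S<W′ = o , o+g≤W , clear
    where
    open ≤-Reasoning
    cost : ℕ → ℕ → ℕ
    cost w l = 𝟙 (X * g + l <ᵇ k) * z (p (X * g + l) + v) ((X + u) * W + (w + l))
    per-entry : ∀ l → l < g → ∑[ w < W′ ] cost w l ≤ h v (X + u) (X * g + l)
    per-entry l l<g = begin
      ∑[ w < W′ ] cost w l
        ≡⟨ ∑-*ˡ W′ (𝟙 (X * g + l <ᵇ k)) _ ⟩
      𝟙 (X * g + l <ᵇ k) * ∑[ w < W′ ] z (p (X * g + l) + v) ((X + u) * W + (w + l))
        ≡⟨ cong (𝟙 (X * g + l <ᵇ k) *_) (∑-cong W′ (λ w →
             cong (λ t → z (p (X * g + l) + v) ((X + u) * W + t)) (+-comm w l))) ⟩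
      𝟙 (X * g + l <ᵇ k) * ∑[ w < W′ ] z (p (X * g + l) + v) ((X + u) * W + (l + w))
        ≤⟨ *-monoʳ-≤ (𝟙 (X * g + l <ᵇ k))
             (∑-window-≤ l W′ (λ w → z (p (X * g + l) + v) ((X + u) * W + w))
               (≤-trans (+-monoˡ-≤ W′ (<⇒≤ l<g)) (≤-reflexive (m+[n∸m]≡n g≤W)))) ⟩
      h v (X + u) (X * g + l) ∎
    total : ∑[ w < W′ ] (∑[ l < g ] cost w l) < W′ * 1
    total = begin-strict
      ∑[ w < W′ ] (∑[ l < g ] cost w l)   ≡⟨ ∑-swap W′ g _ ⟩
      ∑[ l < g ] (∑[ w < W′ ] cost w l)   ≤⟨ ∑-mono-≤ g per-entry ⟩
      ∑[ l < g ] h v (X + u) (X * g + l)  <⟨ S<W′ ⟩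
      W′                                  ≡⟨ sym (*-identityʳ W′) ⟩
      W′ * 1                              ∎
    found = ∑-average W′ (λ w → ∑[ l < g ] cost w l) total
    o = proj₁ found
    o+g≤W : o + g ≤ W
    o+g≤W = ≤-trans (+-monoˡ-≤ g (<⇒≤ (proj₁ (proj₂ found)))) (≤-reflexive (m∸n+n≡m g≤W))
    clear : ∀ l → l < g → X * g + l < k →
            B (p (X * g + l) + v) ((X + u) * W + (o + l)) ≡ true
    clear l l<g j<k = not≡false _ (𝟙≡0⇒false _ (n<1⇒n≡0
      (≤-<-trans (≤-trans (≤-reflexive uncost) (term≤∑ (cost o) l<g)) (proj₂ (proj₂ found)))))
      where
      uncost : z (p (X * g + l) + v) ((X + u) * W + (o + l)) ≡ cost o l
      uncost = sym (trans
        (cong (λ t → 𝟙 t * z (p (X * g + l) + v) ((X + u) * W + (o + l))) (<⇒<ᵇ≡ j<k))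
        (*-identityˡ _))

  -- Averaging fixes `v`, then `u`. The remaining sum over `X` is below `c`, hence so is each term:
  -- the same two shifts serve all groups, while each group takes its own offset.
  placement : ∃[ v ] ∃[ u ] Σ (ℕ → ℕ) λ o → ∀ X → X < s →
    o X + g ≤ W × (∀ l → l < g → X * g + l < k →
      B (p (X * g + l) + v) ((X + u) * W + (o X + l)) ≡ true)
  placement =
    let v , v<k , Σv = ∑-average k _ averages
        u , u<s , Σu = ∑-average s _ Σv
        o , ok = choose {P = λ X w → w + g ≤ W × (∀ l → l < g → X * g + l < k →
                   B (p (X * g + l) + v) ((X + u) * W + (w + l)) ≡ true)} s (λ X X<s →
                   offset {v} {u} {X} (group-zeros-< v<k u<s X<s
                   (≤-<-trans (term≤∑ (λ X → 2 * pairs v X (X + u)) X<s) Σu)))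
    in v , u , o , ok

-- Column `j` has position `j % g` in group `j / g`. Groups stay in order because `o X + g ≤ W`
-- confines each to its own block; inside a group the columns stay consecutive.
placement⇒Emb : ∀ {k} (p : Fin k → Fin k) (B : ℕ → ℕ → Bool) {g s W v u} .⦃ _ : NonZero g ⦄ (o : ℕ → ℕ) →
  k ≤ s * g →
  (∀ X → X < s → o X + g ≤ W × (∀ l → l < g → X * g + l < k →
    B (extend p (X * g + l) + v) ((X + u) * W + (o X + l)) ≡ true)) →
  Emb p B
placement⇒Emb {k} p B {g} {s} {W} {v} {u} o k≤sg ok =
  (λ i → toℕ i + v) , (λ j → position (toℕ j)) ,
  (λ i j i<j → +-monoˡ-< v i<j) , position-mono , hits
  where
  open ≤-Reasoning
  position : ℕ → ℕ
  position j = (j / g + u) * W + (o (j / g) + j % g)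

  group< : ∀ (j : Fin k) → toℕ j / g < s
  group< j = m<n*o⇒m/o<n (<-≤-trans (Fin.toℕ<n j) k≤sg)

  position-mono : ∀ i j → i <ᶠ j → position (toℕ i) < position (toℕ j)
  position-mono i j i<j with m≤n⇒m<n∨m≡n (/-monoˡ-≤ g (<⇒≤ i<j))
  ... | inj₁ X<X′ = begin-strict
    (toℕ i / g + u) * W + (o (toℕ i / g) + toℕ i % g)
      <⟨ +-monoʳ-< ((toℕ i / g + u) * W)
           (<-≤-trans (+-monoʳ-< (o (toℕ i / g)) (m%n<n (toℕ i) g)) (proj₁ (ok _ (group< i)))) ⟩
    (toℕ i / g + u) * W + W
      ≡⟨ +-comm _ W ⟩
    suc (toℕ i / g + u) * W
      ≤⟨ *-monoˡ-≤ W (+-monoˡ-≤ u X<X′) ⟩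
    (toℕ j / g + u) * W
      ≤⟨ m≤m+n _ _ ⟩
    position (toℕ j) ∎
  ... | inj₂ X≡X′ = begin-strict
    (toℕ i / g + u) * W + (o (toℕ i / g) + toℕ i % g)
      <⟨ +-monoʳ-< ((toℕ i / g + u) * W) (+-monoʳ-< (o (toℕ i / g)) l<l′) ⟩
    (toℕ i / g + u) * W + (o (toℕ i / g) + toℕ j % g)
      ≡⟨ cong (λ X → (X + u) * W + (o X + toℕ j % g)) X≡X′ ⟩
    position (toℕ j) ∎
    where
    l<l′ : toℕ i % g < toℕ j % g
    l<l′ = +-cancelʳ-< (toℕ i / g * g) _ _ (begin-strict
      toℕ i % g + toℕ i / g * g  ≡⟨ sym (m≡m%n+[m/n]*n (toℕ i) g) ⟩
      toℕ i                      <⟨ i<j ⟩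
      toℕ j                      ≡⟨ m≡m%n+[m/n]*n (toℕ j) g ⟩
      toℕ j % g + toℕ j / g * g  ≡⟨ cong (λ X → toℕ j % g + X * g) (sym X≡X′) ⟩
      toℕ j % g + toℕ i / g * g  ∎)

  hits : ∀ j → B (toℕ (p j) + v) (position (toℕ j)) ≡ true
  hits j = subst (λ x → B (x + v) (position (toℕ j)) ≡ true) (extend-toℕ p j)
             (subst (λ t → B (extend p t + v) (position (toℕ j)) ≡ true) (sym split)
               (proj₂ (ok (toℕ j / g) (group< j)) (toℕ j % g) (m%n<n (toℕ j) g)
                 (≤-<-trans (≤-reflexive (sym split)) (Fin.toℕ<n j))))
    where
    split : toℕ j ≡ toℕ j / g * g + toℕ j % g
    split = trans (m≡m%n+[m/n]*n (toℕ j) g) (+-comm (toℕ j % g) _)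

sparse-zeros⇒Emb : ∀ {k r} (p : Fin k → Fin k) → FewRepetitions k r (extend p) →
  (B : ℕ → ℕ → Bool) {g s W a b : ℕ} →
  (∀ x → x < k + k → ∑[ y < 2 * s * W ] 𝟙 (not (B x y)) ≤ a) →
  (∀ y → y < 2 * s * W → ∑[ x < k + k ] 𝟙 (not (B x y)) ≤ b) →
  2 * g ≤ W → 4 * a ≤ W → 0 < s → 0 < g → k ≤ s * g →
  32 * g * r * (b * b) < k → Emb p B
sparse-zeros⇒Emb p few B rows columns 2g≤W 4a≤W 0<s 0<g k≤sg sparse =
  let v , u , o , ok = SparseZeros.placement (extend p) (extend-< p) few B
                         rows columns 2g≤W 4a≤W 0<s 0<g sparse
  in placement⇒Emb p B ⦃ >-nonZero 0<g ⦄ o k≤sg ok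

-- Interval minors

Increasing : (ℕ → ℕ → Set) → Set
Increasing R = ∀ {i j x y} → R i x → R j y → i < j → x < y

-- A permutation matrix has a single one in each row and column, so a representative in `A` can be
-- chosen for each one independently; the order of the classes `R` and `C` keeps the representatives
-- in order.
minor-Emb : ∀ {k} {p q : Fin k → Fin k} → (∀ i → p (q i) ≡ i) → (∀ j → q (p j) ≡ j) →
  (R C : ℕ → ℕ → Set) → Increasing R → Increasing C → (A B : ℕ → ℕ → Bool) →
  (∀ i j → B i j ≡ true → ∃[ x ] ∃[ y ] (R i x × C j y × A x y ≡ true)) →
  Emb p B → Emb p A
minor-Emb {k} {p} {q} pq qp R C incR incC A B lift (a , b , a-mono , b-mono , hit) =
  (λ i → row (q i)) , col ,
  (λ i j i<j → incR (inRow i) (inRow j) (a-mono i j i<j)) ,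
  (λ i j i<j → incC (proj₁ (proj₂ (proj₂ (proj₂ (w i))))) (proj₁ (proj₂ (proj₂ (proj₂ (w j)))))
                 (b-mono i j i<j)) ,
  (λ j → subst (λ j′ → A (row j′) (col j) ≡ true) (sym (qp j))
           (proj₂ (proj₂ (proj₂ (proj₂ (w j))))))
  where
  w : ∀ j → ∃[ x ] ∃[ y ] (R (a (p j)) x × C (b j) y × A x y ≡ true)
  w j = lift (a (p j)) (b j) (hit j)
  row col : Fin k → ℕ
  row j = proj₁ (w j)
  col j = proj₁ (proj₂ (w j))
  inRow : ∀ i → R (a i) (row (q i))
  inRow i = subst (λ i′ → R (a i′) (row (q i))) (pq i) (proj₁ (proj₂ (proj₂ (w (q i)))))

InBlock : ℕ → ℕ → ℕ → ℕ → Set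
InBlock o l i x = ∃[ c ] (c < l × x ≡ o + i * l + c)

inBlock-increasing : ∀ o l → Increasing (InBlock o l)
inBlock-increasing o l {i} {j} (c , c<l , refl) (d , d<l , refl) i<j = begin-strict
  o + i * l + c    <⟨ +-monoʳ-< (o + i * l) c<l ⟩
  o + i * l + l    ≡⟨ trans (+-assoc o (i * l) l) (cong (o +_) (+-comm (i * l) l)) ⟩
  o + suc i * l    ≤⟨ +-monoʳ-≤ o (*-monoˡ-≤ l i<j) ⟩
  o + j * l        ≤⟨ m≤m+n _ d ⟩
  o + j * l + d    ∎
  where open ≤-Reasoning

∀<⊎∃≤ : ∀ n c (f : ℕ → ℕ) → (∀ i → i < n → c < f i) ⊎ ∃[ i ] (i < n × f i ≤ c)
∀<⊎∃≤ zero    c f = inj₁ (λ _ ())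
∀<⊎∃≤ (suc n) c f with f 0 ≤? c | ∀<⊎∃≤ n c (λ i → f (suc i))
... | yes f0≤c | _                     = inj₂ (0 , z<s , f0≤c)
... | no  _    | inj₂ (i , i<n , fi≤c) = inj₂ (suc i , s<s i<n , fi≤c)
... | no  f0≰c | inj₁ c<f              =
  inj₁ (λ { zero _ → ≰⇒> f0≰c ; (suc i) (s≤s i<n) → c<f i i<n })

𝟙-mono : ∀ {b c} → (b ≡ true → c ≡ true) → 𝟙 b ≤ 𝟙 c
𝟙-mono {false} h = z≤n
𝟙-mono {true}  h rewrite h refl = ≤-refl

-- Density increment in a vertical strip

module DensityIncrement (C : ℕ → ℕ → Bool) (t N : ℕ) .⦃ _ : NonZero N ⦄ where

  touched : ℕ → ℕ → ℕ → Bool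
  touched o l y = any l (λ i → C (o + i) y)

  width : ℕ → ℕ → ℕ
  width o l = count t (touched o l)

  touched-mono : ∀ o l c {o′ l′ y} → o ≡ o′ + c → c + l ≤ l′ →
                 touched o l y ≡ true → touched o′ l′ y ≡ true
  touched-mono o l c {o′} {l′} {y} refl c+l≤l′ h =
    let i , i<l , Cy = any⇒∃ l _ h
    in ∃⇒any (λ i → C (o′ + i) y) (<-≤-trans (+-monoʳ-< c i<l) c+l≤l′)
         (subst (λ x → C x y ≡ true) (+-assoc o′ c i) Cy)

  row≤width : ∀ o l → 0 < l → count t (C o) ≤ width o l
  row≤width o l 0<l = ∑-mono-≤ t (λ y _ → 𝟙-mono (λ Cy →
    ∃⇒any (λ i → C (o + i) y) 0<l (subst (λ x → C x y ≡ true) (sym (+-identityʳ o)) Cy)))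

  -- No chunk misses a fraction 1 / (M + 1) or more of the columns hit by the interval; multiplied
  -- out to avoid division.
  Balanced : ℕ → ℕ → ℕ → Set
  Balanced M o l = ∀ ρ → ρ < N → M * width o (N * l) < suc M * width (o + ρ * l) l

  -- An interval of length `N ^ suc D` is either balanced, or has a chunk keeping at most the
  -- fraction M / (M + 1) of its width, into which the search descends. After all scales a single
  -- row is left and the fractions have multiplied up.
  search : ∀ M D o →
    (∃[ o′ ] ∃[ l ] (0 < l × o′ + N * l ≤ o + N ^ D × Balanced M o′ l)) ⊎
    (∃[ o′ ] (o′ < o + N ^ D × suc M ^ D * width o′ 1 ≤ M ^ D * width o (N ^ D)))
  search M zero    o = inj₂ (o , m<m+n o z<s , ≤-refl)
  search M (suc D) o with ∀<⊎∃≤ N (M * width o (N * l)) (λ ρ → suc M * width (o + ρ * l) l)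
    where l = N ^ D
  ... | inj₁ balanced = inj₁ (o , N ^ D , m^n>0 N D , ≤-refl , balanced)
  ... | inj₂ (ρ , ρ<N , drop) with search M D (o + ρ * N ^ D)
  ...   | inj₁ (o′ , l , 0<l , end , balanced) =
            inj₁ (o′ , l , 0<l , ≤-trans end inside , balanced)
    where
    inside : o + ρ * N ^ D + N ^ D ≤ o + N * N ^ D
    inside = ≤-trans (≤-reflexive (trans (+-assoc o _ _) (cong (o +_) (+-comm _ (N ^ D)))))
                     (+-monoʳ-≤ o (*-monoˡ-≤ (N ^ D) ρ<N))
  ...   | inj₂ (o′ , o′< , small) = inj₂ (o′ , <-≤-trans o′< inside , (begin
            suc M * suc M ^ D * width o′ 1
              ≡⟨ *-assoc (suc M) (suc M ^ D) (width o′ 1) ⟩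
            suc M * (suc M ^ D * width o′ 1)
              ≤⟨ *-monoʳ-≤ (suc M) small ⟩
            suc M * (M ^ D * w)
              ≡⟨ exchange (suc M) (M ^ D) w ⟩
            M ^ D * (suc M * w)
              ≤⟨ *-monoʳ-≤ (M ^ D) drop ⟩
            M ^ D * (M * width o (N * N ^ D))
              ≡⟨ trans (sym (*-assoc (M ^ D) M _)) (cong (_* width o (N * N ^ D)) (*-comm (M ^ D) M)) ⟩
            M * M ^ D * width o (N * N ^ D) ∎))
    where
    open ≤-Reasoning
    w = width (o + ρ * N ^ D) (N ^ D)
    exchange : ∀ a b c → a * (b * c) ≡ b * (a * c)
    exchange = solve-∀
    inside : o + ρ * N ^ D + N ^ D ≤ o + N * N ^ D
    inside = ≤-trans (≤-reflexive (trans (+-assoc o _ _) (cong (o +_) (+-comm _ (N ^ D)))))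
                     (+-monoʳ-≤ o (*-monoˡ-≤ (N ^ D) ρ<N))

  -- After `D` losses the surviving row would have fewer than `τ` ones, against `dense`. A balanced
  -- interval inherits width at least `τ` from its first row.
  balanced-interval : ∀ M D {τ} → (∀ x → x < N ^ D → τ ≤ count t (C x)) →
    M ^ D * t < suc M ^ D * τ →
    ∃[ o ] ∃[ l ] (τ ≤ width o (N * l) × Balanced M o l)
  balanced-interval M D {τ} dense decay with search M D 0
  ... | inj₁ (o , l , 0<l , end , balanced) =
    o , l , ≤-trans (dense o (<-≤-trans (m<m+n o 0<Nl) end)) (row≤width o (N * l) 0<Nl) , balanced
    where
    0<Nl : 0 < N * l
    0<Nl = *-mono-≤ (>-nonZero⁻¹ N) 0<l
  ... | inj₂ (o , o< , small) = contradiction decay (≤⇒≯ (begin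
    suc M ^ D * τ          ≤⟨ *-monoʳ-≤ (suc M ^ D) (≤-trans (dense o o<) (row≤width o 1 z<s)) ⟩
    suc M ^ D * width o 1  ≤⟨ small ⟩
    M ^ D * width 0 (N ^ D) ≤⟨ *-monoʳ-≤ (M ^ D) (count≤ t (touched 0 (N ^ D))) ⟩
    M ^ D * t              ∎))
    where open ≤-Reasoning

  module BalancedInterval (M o l : ℕ) (balanced : Balanced M o l) where

    B : ℕ → ℕ → Bool
    B ρ = touched (o + ρ * l) l

    used good : ℕ → Bool
    used = touched o (N * l)
    columnZeros : ℕ → ℕ
    columnZeros y = ∑[ ρ < N ] 𝟙 (not (B ρ y))
    good y = used y ∧ (suc M * columnZeros y ≤ᵇ 2 * N)

    u G : ℕ
    u = count t used
    G = count t good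

    rowZeros : ℕ → ℕ
    rowZeros ρ = ∑[ y < t ] (𝟙 (used y) * 𝟙 (not (B ρ y)))

    B⇒used : ∀ ρ y → ρ < N → B ρ y ≡ true → used y ≡ true
    B⇒used ρ y ρ<N = touched-mono (o + ρ * l) l (ρ * l) refl
      (≤-trans (≤-reflexive (+-comm (ρ * l) l)) (*-monoˡ-≤ l ρ<N))

    rowZeros-≤ : ∀ ρ → ρ < N → suc M * rowZeros ρ ≤ u
    rowZeros-≤ ρ ρ<N = +-cancelʳ-≤ (M * u) _ _ (begin
      suc M * rowZeros ρ + M * u
        ≤⟨ +-monoʳ-≤ (suc M * rowZeros ρ) (<⇒≤ (balanced ρ ρ<N)) ⟩
      suc M * rowZeros ρ + suc M * count t (B ρ)
        ≡⟨ sym (*-distribˡ-+ (suc M) (rowZeros ρ) (count t (B ρ))) ⟩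
      suc M * (rowZeros ρ + count t (B ρ))
        ≡⟨ cong (suc M *_) (sym (∑-+ t _ _)) ⟩
      suc M * ∑[ y < t ] (𝟙 (used y) * 𝟙 (not (B ρ y)) + 𝟙 (B ρ y))
        ≤⟨ *-monoʳ-≤ (suc M) (∑-mono-≤ t (λ y _ → split (used y) (B ρ y) (B⇒used ρ y ρ<N))) ⟩
      suc M * u ∎)
      where
      open ≤-Reasoning
      split : ∀ b c → (c ≡ true → b ≡ true) → 𝟙 b * 𝟙 (not c) + 𝟙 c ≤ 𝟙 b
      split b true  h rewrite h refl = ≤-refl
      split b false h = ≤-reflexive (trans (+-identityʳ _) (*-identityʳ (𝟙 b)))

    -- Markov's inequality: used columns contain at most N u / (M + 1) zeros in all, and a used
    -- column that is not good has more than 2 N / (M + 1), so at most half of the used columns are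
    -- lost.
    good-many : u ≤ 2 * G
    good-many = *-cancelˡ-≤ N (+-cancelˡ-≤ (N * u) _ _ (begin
      N * u + N * u
        ≡⟨ double N u ⟩
      2 * N * u
        ≡⟨ sym (∑-*ˡ t (2 * N) (λ y → 𝟙 (used y))) ⟩
      ∑[ y < t ] (2 * N * 𝟙 (used y))
        ≤⟨ ∑-mono-≤ t (λ y _ → markov y) ⟩
      ∑[ y < t ] (suc M * (𝟙 (used y) * columnZeros y) + 2 * N * 𝟙 (good y))
        ≡⟨ trans (∑-+ t _ _) (cong₂ _+_ (∑-*ˡ t (suc M) _) (∑-*ˡ t (2 * N) _)) ⟩
      suc M * ∑[ y < t ] (𝟙 (used y) * columnZeros y) + 2 * N * G
        ≡⟨ cong (λ z → suc M * z + 2 * N * G) count-zeros ⟩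
      suc M * ∑ N rowZeros + 2 * N * G
        ≡⟨ cong (_+ 2 * N * G) (sym (∑-*ˡ N (suc M) rowZeros)) ⟩
      ∑[ ρ < N ] (suc M * rowZeros ρ) + 2 * N * G
        ≤⟨ +-monoˡ-≤ (2 * N * G) (≤-trans (∑-mono-≤ N rowZeros-≤) (≤-reflexive (∑-const N u))) ⟩
      N * u + 2 * N * G
        ≡⟨ cong (N * u +_) (commute N G) ⟩
      N * u + N * (2 * G) ∎))
      where
      open ≤-Reasoning
      double : ∀ n u → n * u + n * u ≡ 2 * n * u
      double = solve-∀
      commute : ∀ n g → 2 * n * g ≡ n * (2 * g)
      commute = solve-∀
      count-zeros : ∑[ y < t ] (𝟙 (used y) * columnZeros y) ≡ ∑ N rowZeros
      count-zeros = trans (∑-cong t (λ y → sym (∑-*ˡ N (𝟙 (used y)) _))) (∑-swap t N _)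
      markov : ∀ y → 2 * N * 𝟙 (used y) ≤
                     suc M * (𝟙 (used y) * columnZeros y) + 2 * N * 𝟙 (good y)
      markov y with used y
      ... | false = ≤-trans (≤-reflexive (*-zeroʳ (2 * N))) z≤n
      ... | true with (suc M * columnZeros y ≤ᵇ 2 * N) in eq
      ...   | true  = m≤n+m _ _
      ...   | false = begin
        2 * N * 1                              ≡⟨ *-identityʳ (2 * N) ⟩
        2 * N                                  ≤⟨ <⇒≤ (≰⇒> not-good) ⟩
        suc M * columnZeros y                  ≡⟨ cong (suc M *_) (sym (+-identityʳ _)) ⟩
        suc M * (1 * columnZeros y)            ≤⟨ m≤m+n _ _ ⟩
        suc M * (1 * columnZeros y) + 2 * N * 0 ∎
        where
        not-good : ¬ (suc M * columnZeros y ≤ 2 * N)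
        not-good le with trans (sym (T⇒≡ (≤⇒≤ᵇ le))) eq
        ... | ()

    selected : ℕ → ℕ → Bool
    selected ρ i = B ρ (nth good t i)

    selected-rows : ∀ {m} → m ≤ G → ∀ ρ → ρ < N →
                    suc M * ∑[ i < m ] 𝟙 (not (selected ρ i)) ≤ u
    selected-rows {m} m≤G ρ ρ<N = begin
      suc M * ∑[ i < m ] 𝟙 (not (selected ρ i))
        ≤⟨ *-monoʳ-≤ (suc M) (∑-≤-length _ m≤G) ⟩
      suc M * ∑[ i < G ] 𝟙 (not (selected ρ i))
        ≡⟨ cong (suc M *_) (∑-nth good t (λ y → 𝟙 (not (B ρ y)))) ⟩
      suc M * ∑[ y < t ] (𝟙 (good y) * 𝟙 (not (B ρ y)))
        ≤⟨ *-monoʳ-≤ (suc M) (∑-mono-≤ t (λ y _ →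
             *-monoˡ-≤ (𝟙 (not (B ρ y))) (𝟙-mono {good y} (λ h → proj₁ (∧-true (used y) h))))) ⟩
      suc M * rowZeros ρ
        ≤⟨ rowZeros-≤ ρ ρ<N ⟩
      u ∎
      where open ≤-Reasoning

    selected-columns : ∀ {m} → m ≤ G → ∀ i → i < m →
                       suc M * ∑[ ρ < N ] 𝟙 (not (selected ρ i)) ≤ 2 * N
    selected-columns m≤G i i<m =
      ≤ᵇ⇒≤ _ _ (≡⇒T (proj₂ (∧-true (used (nth good t i)) (nth-true good t (<-≤-trans i<m m≤G)))))

    selected-Emb : ∀ {k} {p q : Fin k → Fin k} → (∀ i → p (q i) ≡ i) → (∀ j → q (p j) ≡ j) →
                   Emb p selected → Emb p C
    selected-Emb pq qp = minor-Emb pq qp (InBlock o l) (λ j y → y ≡ nth good t j)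
      (inBlock-increasing o l)
      -- The embedding bounds no column index, hence the need for `nth` to increase on all of ℕ.
      (λ { refl refl i<j → nth-mono good t i<j })
      C selected
      (λ ρ j h → let i , i<l , Cy = any⇒∃ l _ h
                 in _ , _ , (i , i<l , refl) , refl , Cy)

-- Parameters for a strip

bernoulli : ∀ m n → m ^ suc n + suc n * m ^ n ≤ suc m ^ suc n
bernoulli m zero    = ≤-reflexive (+-comm (m * 1) 1)
bernoulli m (suc n) = begin
  m * (m * c) + suc (suc n) * (m * c)
    ≤⟨ m≤m+n _ (suc n * c) ⟩
  m * (m * c) + suc (suc n) * (m * c) + suc n * c
    ≡⟨ expand m n c ⟩
  suc m * (m * c + suc n * c)
    ≤⟨ *-monoʳ-≤ (suc m) (bernoulli m n) ⟩
  suc m ^ suc (suc n) ∎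
  where
  open ≤-Reasoning
  c = m ^ n
  expand : ∀ m n c → m * (m * c) + suc (suc n) * (m * c) + suc n * c ≡
                     suc m * (m * c + suc n * c)
  expand = solve-∀

-- The case `n = m` of `bernoulli`, where the second term is at least `m ^ suc m`. In the density
-- increment it says that M + 1 losses at least halve the width.
halving : ∀ m → 2 * m ^ suc m ≤ suc m ^ suc m
halving m = begin
  2 * m ^ suc m                  ≡⟨ cong (m ^ suc m +_) (+-identityʳ (m ^ suc m)) ⟩
  m ^ suc m + m ^ suc m          ≤⟨ +-monoʳ-≤ (m ^ suc m) (m≤n+m _ (m ^ m)) ⟩
  m ^ suc m + suc m * m ^ m      ≤⟨ bernoulli m m ⟩
  suc m ^ suc m                  ∎
  where open ≤-Reasoning

^-distribʳ-* : ∀ j m n → (m * n) ^ j ≡ m ^ j * n ^ j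
^-distribʳ-* zero    m n = refl
^-distribʳ-* (suc j) m n =
  trans (cong (m * n *_) (^-distribʳ-* j m n)) (interchange m n (m ^ j) (n ^ j))
  where
  interchange : ∀ a b c d → a * b * (c * d) ≡ a * c * (b * d)
  interchange = solve-∀

m*n≤o⇒m≤o/n : ∀ m n o .⦃ _ : NonZero n ⦄ → m * n ≤ o → m ≤ o / n
m*n≤o⇒m≤o/n m n o h = ≤-trans (≤-reflexive (sym (m*n/n≡m m n))) (/-monoˡ-≤ n h)

decay : ∀ m j → 2 ^ j * m ^ (suc m * j) ≤ suc m ^ (suc m * j)
decay m j = begin
  2 ^ j * m ^ (suc m * j)      ≡⟨ cong (2 ^ j *_) (sym (^-*-assoc m (suc m) j)) ⟩
  2 ^ j * (m ^ suc m) ^ j      ≡⟨ sym (^-distribʳ-* j 2 (m ^ suc m)) ⟩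
  (2 * m ^ suc m) ^ j          ≤⟨ ^-monoˡ-≤ j (halving m) ⟩
  (suc m ^ suc m) ^ j          ≡⟨ ^-*-assoc (suc m) (suc m) j ⟩
  suc m ^ (suc m * j)          ∎
  where open ≤-Reasoning

strip-Emb : ∀ {k r s L} {p q : Fin k → Fin k} → (∀ i → p (q i) ≡ i) → (∀ j → q (p j) ≡ j) →
  FewRepetitions k r (extend p) → 0 < k → 0 < s → s ≤ k → k ≤ 2 ^ L → r * k ^ 2 ≤ s ^ 3 →
  (C : ℕ → ℕ → Bool) → let τ = 2 ^ (4 + L) in
  (∀ x → x < (k + k) ^ (64 * s * (6 + L)) → τ ≤ count (2 * τ * τ) (C x)) → Emb p C
strip-Emb {k} {r} {s@(suc s-1)} {L} {p} {q} pq qp few 0<k 0<s s≤k k≤2^L rk²≤s³ C dense =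
  selected-Emb pq qp
    (sparse-zeros⇒Emb p few selected {g} {s} {W}
      (λ x x<2k → divide (selected-rows 2sW≤G x x<2k))
      (λ y y< → divide (selected-columns 2sW≤G y y<))
      2g≤W 4a≤W 0<s z<s k≤sg sparse)
  where
  open ≤-Reasoning
  -- At least 16 k, which gives a block of width about u / (4 s) room for two groups.
  τ = 2 ^ (4 + L)
  t = 2 * τ * τ
  M = 63 + 64 * s-1
  suc-M : suc M ≡ 64 * s
  suc-M = sym (*-distribˡ-+ 64 1 s-1)
  -- This many losses divide the width by at least 2 ^ (6 + L), more than t / τ = 2 ^ (5 + L).
  D = suc M * (6 + L)
  instance
    2k≢0 : NonZero (k + k)
    2k≢0 = >-nonZero (≤-trans 0<k (m≤m+n k k))
  open DensityIncrement C t (k + k)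

  M^Dt<suc-M^Dτ : M ^ D * t < suc M ^ D * τ
  M^Dt<suc-M^Dτ = begin-strict
    M ^ D * (2 * τ * τ)                ≡⟨ sym (*-assoc (M ^ D) (2 * τ) τ) ⟩
    M ^ D * (2 * τ) * τ                <⟨ *-monoˡ-< τ ⦃ m^n≢0 2 (4 + L) ⦄ step ⟩
    suc M ^ D * τ                      ∎
    where
    step : M ^ D * (2 * τ) < suc M ^ D
    step = begin-strict
      M ^ D * (2 * τ)           <⟨ *-monoʳ-< (M ^ D) ⦃ m^n≢0 M D ⦄
                                     (^-monoʳ-< 2 (≤-refl {2}) (≤-refl {6 + L})) ⟩
      M ^ D * 2 ^ (6 + L)       ≡⟨ *-comm (M ^ D) _ ⟩
      2 ^ (6 + L) * M ^ D       ≤⟨ decay M (6 + L) ⟩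
      suc M ^ D                 ∎

  interval = balanced-interval M D {τ}
    (λ x x< → dense x (<-≤-trans x< (≤-reflexive (cong (λ e → (k + k) ^ (e * (6 + L))) suc-M))))
    M^Dt<suc-M^Dτ
  τ≤u = proj₁ (proj₂ (proj₂ interval))
  open BalancedInterval M (proj₁ interval) (proj₁ (proj₂ interval)) (proj₂ (proj₂ (proj₂ interval)))

  g W a b : ℕ
  -- `s` groups of size `g` cover all columns, the 2 s blocks of width `W` fit into u / 2 ≤ G good
  -- columns, and `a`, `b` are the zero bounds per row and per column of the balanced interval.
  g = suc (k / s)
  W = u / (4 * s)
  a = u / suc M
  b = 2 * (k + k) / suc M

  divide : ∀ {x y} → suc M * x ≤ y → x ≤ y / suc M
  divide {x} {y} h = m*n≤o⇒m≤o/n x (suc M) y (≤-trans (≤-reflexive (*-comm x (suc M))) h)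

  2sW≤G : 2 * s * W ≤ G
  2sW≤G = *-cancelˡ-≤ 2 (begin
    2 * (2 * s * W)      ≡⟨ regroup s W ⟩
    W * (4 * s)          ≤⟨ m/n*n≤m u (4 * s) ⟩
    u                    ≤⟨ good-many ⟩
    2 * G                ∎)
    where
    regroup : ∀ s w → 2 * (2 * s * w) ≡ w * (4 * s)
    regroup = solve-∀

  gs≤2k : g * s ≤ 2 * k
  gs≤2k = begin
    s + k / s * s  ≤⟨ +-mono-≤ s≤k (m/n*n≤m k s) ⟩
    k + k          ≡⟨ cong (k +_) (sym (+-identityʳ k)) ⟩
    2 * k          ∎

  k≤sg : k ≤ s * g
  k≤sg = begin
    k                    ≡⟨ m≡m%n+[m/n]*n k s ⟩
    k % s + k / s * s    ≤⟨ +-monoˡ-≤ _ (<⇒≤ (m%n<n k s)) ⟩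
    g * s                ≡⟨ *-comm g s ⟩
    s * g                ∎

  2g≤W : 2 * g ≤ W
  2g≤W = m*n≤o⇒m≤o/n (2 * g) (4 * s) u (begin
    2 * g * (4 * s)      ≡⟨ regroup g s ⟩
    8 * (g * s)          ≤⟨ *-monoʳ-≤ 8 gs≤2k ⟩
    8 * (2 * k)          ≡⟨ sym (*-assoc 8 2 k) ⟩
    16 * k               ≤⟨ *-monoʳ-≤ 16 k≤2^L ⟩
    2 ^ 4 * 2 ^ L        ≡⟨ sym (^-distribˡ-+-* 2 4 L) ⟩
    τ                    ≤⟨ τ≤u ⟩
    u                    ∎)
    where
    regroup : ∀ g s → 2 * g * (4 * s) ≡ 8 * (g * s)
    regroup = solve-∀

  4a≤W : 4 * a ≤ W
  4a≤W = m*n≤o⇒m≤o/n (4 * a) (4 * s) u (begin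
    4 * a * (4 * s)      ≡⟨ regroup a s ⟩
    a * (16 * s)         ≤⟨ *-monoʳ-≤ a (*-monoˡ-≤ s (m≤m+n 16 48)) ⟩
    a * (64 * s)         ≡⟨ cong (a *_) (sym suc-M) ⟩
    a * suc M            ≤⟨ m/n*n≤m u (suc M) ⟩
    u                    ∎)
    where
    regroup : ∀ a s → 4 * a * (4 * s) ≡ a * (16 * s)
    regroup = solve-∀

  16bs≤k : 16 * (b * s) ≤ k
  16bs≤k = *-cancelˡ-≤ 4 (begin
    4 * (16 * (b * s))   ≡⟨ regroup b s ⟩
    b * (64 * s)         ≡⟨ cong (b *_) (sym suc-M) ⟩
    b * suc M            ≤⟨ m/n*n≤m (2 * (k + k)) (suc M) ⟩
    2 * (k + k)          ≡⟨ four k ⟩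
    4 * k                ∎)
    where
    regroup : ∀ b s → 4 * (16 * (b * s)) ≡ b * (64 * s)
    regroup = solve-∀
    four : ∀ k → 2 * (k + k) ≡ 4 * k
    four = solve-∀

  sparse : 32 * g * r * (b * b) < k
  -- From `gs≤2k` and `16bs≤k` the left side is at most r k³ / (4 s³), and `rk²≤s³` makes this at
  -- most k / 4. The factor 8 s³ clears the denominators.
  sparse = *-cancelʳ-< (8 * s ^ 3) _ _ (begin-strict
    32 * g * r * (b * b) * (8 * s ^ 3)
      ≡⟨ regroup g r b s ⟩
    g * s * r * ((16 * (b * s)) * (16 * (b * s)))
      ≤⟨ *-mono-≤ (*-monoˡ-≤ r gs≤2k) (*-mono-≤ 16bs≤k 16bs≤k) ⟩
    2 * k * r * (k * k)
      ≡⟨ regroup′ k r ⟩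
    2 * (k * (r * k ^ 2))
      ≤⟨ *-monoʳ-≤ 2 (*-monoʳ-≤ k rk²≤s³) ⟩
    2 * (k * s ^ 3)
      <⟨ *-monoˡ-< (k * s ^ 3) ⦃ m*n≢0 k (s ^ 3) ⦃ >-nonZero 0<k ⦄ ⦃ m^n≢0 s 3 ⦄ ⦄ (m≤m+n 3 5) ⟩
    8 * (k * s ^ 3)
      ≡⟨ regroup″ k (s ^ 3) ⟩
    k * (8 * s ^ 3) ∎)
    where
    regroup : ∀ g r b s → 32 * g * r * (b * b) * (8 * (s * (s * (s * 1)))) ≡
                          g * s * r * ((16 * (b * s)) * (16 * (b * s)))
    regroup = solve-∀
    regroup′ : ∀ k r → 2 * k * r * (k * k) ≡ 2 * (k * (r * (k * (k * 1))))
    regroup′ = solve-∀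
    regroup″ : ∀ k x → 8 * (k * x) ≡ k * (8 * x)
    regroup″ = solve-∀

-- Contraction of blocks

onesℕ : ℕ → (ℕ → ℕ → Bool) → ℕ
onesℕ n A = ∑[ i < n ] (∑[ j < n ] 𝟙 (A i j))

transpose : (ℕ → ℕ → Bool) → ℕ → ℕ → Bool
transpose A i j = A j i

transpose-Emb : ∀ {k} {p q : Fin k → Fin k} → (∀ j → q (p j) ≡ j) → (A : ℕ → ℕ → Bool) →
                Emb q (transpose A) → Emb p A
transpose-Emb {p = p} qp A (a , b , a-mono , b-mono , hit) =
  b , a , b-mono , a-mono ,
  (λ j → subst (λ j′ → A (b (p j)) (a j′) ≡ true) (qp j) (hit (p j)))

touchedColumn : ℕ → (ℕ → ℕ → Bool) → ℕ → ℕ → ℕ → Bool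
touchedColumn t A I J y = any t (λ x → A (I * t + x) (J * t + y))

wide : ℕ → ℕ → (ℕ → ℕ → Bool) → ℕ → ℕ → Bool
wide t τ A I J = τ ≤ᵇ count t (touchedColumn t A I J)

contract : ℕ → (ℕ → ℕ → Bool) → ℕ → ℕ → Bool
contract t A I J = any t (λ x → any t (λ y → A (I * t + x) (J * t + y)))

contract-Emb : ∀ {k} {p q : Fin k → Fin k} → (∀ i → p (q i) ≡ i) → (∀ j → q (p j) ≡ j) →
               ∀ t A → Emb p (contract t A) → Emb p A
contract-Emb pq qp t A =
  minor-Emb pq qp (InBlock 0 t) (InBlock 0 t) (inBlock-increasing 0 t) (inBlock-increasing 0 t) A _
    (λ i j h → let x , x<t , h′ = any⇒∃ t (λ x → any t (λ y → A (i * t + x) (j * t + y))) h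
                   y , y<t , Axy = any⇒∃ t (λ y → A (i * t + x) (j * t + y)) h′
               in _ , _ , (x , x<t , refl) , (y , y<t , refl) , Axy)

-- Flattening each wide block of strip `J` to the row of its touched columns gives a contraction of
-- part of `A`. More than `R` such blocks would meet the hypothesis of `strip`.
wide-few : ∀ {k} {p q : Fin k → Fin k} → (∀ i → p (q i) ≡ i) → (∀ j → q (p j) ≡ j) →
  ∀ t {τ R} → (∀ C → (∀ x → x < R → τ ≤ count t (C x)) → Emb p C) →
  ∀ A → ¬ Emb p A → ∀ n J → count n (λ I → wide t τ A I J) ≤ R
wide-few pq qp t {τ} {R} strip A avoids n J = ≮⇒≥ λ R<c → avoids
  (minor-Emb pq qp (λ i → InBlock 0 t (nth φ n i)) (λ j y → y ≡ J * t + j)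
    (λ bi bj i<j → inBlock-increasing 0 t bi bj (nth-mono φ n i<j))
    (λ { refl refl i<j → +-monoʳ-< (J * t) i<j })
    A C
    (λ i j h → let x , x<t , Axy = any⇒∃ t _ h in _ , _ , (x , x<t , refl) , refl , Axy)
    (strip C (λ x x<R → ≤ᵇ⇒≤ τ _ (≡⇒T (nth-true φ n (<-trans x<R R<c))))))
  where
  φ : ℕ → Bool
  φ I = wide t τ A I J
  C : ℕ → ℕ → Bool
  C i = touchedColumn t A (nth φ n i) J

-- The ones of a block that is neither wide nor tall lie in the product of at most `τ` nonempty rows
-- and `τ` nonempty columns. Other blocks are charged all `t * t` entries; `wide-few` makes them
-- rare.
block-ones-≤ : ∀ t τ A I J →
  ∑[ x < t ] (∑[ y < t ] 𝟙 (A (I * t + x) (J * t + y))) ≤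
  τ * τ * 𝟙 (contract t A I J) +
    (t * t * 𝟙 (wide t τ A I J) + t * t * 𝟙 (wide t τ (transpose A) J I))
block-ones-≤ t τ A I J with wide t τ A I J in w | wide t τ (transpose A) J I in w′
... | true | _ =
  ≤-trans trivial (≤-trans (≤-reflexive (sym (*-identityʳ (t * t))))
    (≤-trans (m≤m+n _ _) (m≤n+m _ (τ * τ * 𝟙 (contract t A I J)))))
  where
  trivial : ∑[ x < t ] (∑[ y < t ] 𝟙 (A (I * t + x) (J * t + y))) ≤ t * t
  trivial = ≤-trans (∑-mono-≤ t (λ x _ → count≤ t _)) (≤-reflexive (∑-const t t))
... | false | true =
  ≤-trans trivial (≤-trans (≤-reflexive (sym (*-identityʳ (t * t))))
    (≤-trans (m≤n+m _ (t * t * 0)) (m≤n+m _ (τ * τ * 𝟙 (contract t A I J)))))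
  where
  trivial : ∑[ x < t ] (∑[ y < t ] 𝟙 (A (I * t + x) (J * t + y))) ≤ t * t
  trivial = ≤-trans (∑-mono-≤ t (λ x _ → count≤ t _)) (≤-reflexive (∑-const t t))
... | false | false = ≤-trans thin (m≤m+n _ _)
  where
  open ≤-Reasoning
  row column : ℕ → Bool
  row    = touchedColumn t (transpose A) J I
  column = touchedColumn t A I J
  narrow : ∀ {c} → (τ ≤ᵇ c) ≡ false → c ≤ τ
  narrow {c} eq = ≮⇒≥ λ τ<c → case (trans (sym (T⇒≡ (≤⇒≤ᵇ (<⇒≤ τ<c)))) eq)
    where
    case : true ≡ false → ⊥
    case ()
  entry : ∀ x y → x < t → y < t → 𝟙 (A (I * t + x) (J * t + y)) ≤
          𝟙 (contract t A I J) * 𝟙 (row x) * 𝟙 (column y)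
  entry x y x<t y<t with A (I * t + x) (J * t + y) in eq
  ... | false = z≤n
  ... | true
    rewrite ∃⇒any (λ x → any t (λ y → A (I * t + x) (J * t + y))) x<t
              (∃⇒any (λ y → A (I * t + x) (J * t + y)) y<t eq)
          | ∃⇒any (λ y → A (I * t + x) (J * t + y)) y<t eq
          | ∃⇒any (λ x → A (I * t + x) (J * t + y)) x<t eq = ≤-refl
  thin : ∑[ x < t ] (∑[ y < t ] 𝟙 (A (I * t + x) (J * t + y))) ≤ τ * τ * 𝟙 (contract t A I J)
  thin = begin
    ∑[ x < t ] (∑[ y < t ] 𝟙 (A (I * t + x) (J * t + y)))
      ≤⟨ ∑-mono-≤ t (λ x x<t → ∑-mono-≤ t (λ y y<t → entry x y x<t y<t)) ⟩
    ∑[ x < t ] (∑[ y < t ] (𝟙 (contract t A I J) * 𝟙 (row x) * 𝟙 (column y)))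
      ≡⟨ ∑-cong t (λ x → ∑-*ˡ t (𝟙 (contract t A I J) * 𝟙 (row x)) (λ y → 𝟙 (column y))) ⟩
    ∑[ x < t ] (𝟙 (contract t A I J) * 𝟙 (row x) * count t column)
      ≡⟨ ∑-*ʳ t (count t column) (λ x → 𝟙 (contract t A I J) * 𝟙 (row x)) ⟩
    ∑[ x < t ] (𝟙 (contract t A I J) * 𝟙 (row x)) * count t column
      ≡⟨ cong (_* count t column) (∑-*ˡ t (𝟙 (contract t A I J)) (λ x → 𝟙 (row x))) ⟩
    𝟙 (contract t A I J) * count t row * count t column
      ≤⟨ *-mono-≤ (*-monoʳ-≤ (𝟙 (contract t A I J)) (narrow w′)) (narrow w) ⟩
    𝟙 (contract t A I J) * τ * τ
      ≡⟨ trans (*-assoc (𝟙 (contract t A I J)) τ τ) (*-comm (𝟙 (contract t A I J)) (τ * τ)) ⟩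
    τ * τ * 𝟙 (contract t A I J) ∎

module BlockRecursion {k} {p q : Fin k → Fin k}
  (pq : ∀ i → p (q i) ≡ i) (qp : ∀ j → q (p j) ≡ j) {τ R : ℕ}
  (0<τ : 0 < τ) (0<R : 0 < R)
  (strip-p : ∀ C → (∀ x → x < R → τ ≤ count (2 * τ * τ) (C x)) → Emb p C)
  (strip-q : ∀ C → (∀ x → x < R → τ ≤ count (2 * τ * τ) (C x)) → Emb q C) where

  open ≤-Reasoning

  t : ℕ
  t = 2 * τ * τ

  0<t : 0 < t
  0<t = *-mono-≤ {1} {2 * τ} (≤-trans 0<τ (m≤m+n τ _)) 0<τ

  blocks : ∀ n A → onesℕ (n * t) A ≡
    ∑[ I < n ] (∑[ J < n ] (∑[ x < t ] (∑[ y < t ] 𝟙 (A (I * t + x) (J * t + y)))))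
  blocks n A =
    trans (∑-blocks n t _)
          (∑-cong n (λ I → trans (∑-cong t (λ x → ∑-blocks n t _)) (∑-swap t n _)))

  recursion : ∀ n A → ¬ Emb p A →
    onesℕ (n * t) A ≤ τ * τ * onesℕ n (contract t A) + (t * t * (n * R) + t * t * (n * R))
  recursion n A avoids = begin
    onesℕ (n * t) A
      ≡⟨ blocks n A ⟩
    ∑[ I < n ] (∑[ J < n ] (∑[ x < t ] (∑[ y < t ] 𝟙 (A (I * t + x) (J * t + y)))))
      ≤⟨ ∑-mono-≤ n (λ I _ → ∑-mono-≤ n (λ J _ → block-ones-≤ t τ A I J)) ⟩
    ∑[ I < n ] (∑[ J < n ] (τ * τ * c I J + (t * t * w I J + t * t * w′ I J)))
      ≡⟨ distribute ⟩
    τ * τ * ∑∑ c + (t * t * ∑∑ w + t * t * ∑∑ w′)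
      ≤⟨ +-monoʳ-≤ (τ * τ * ∑∑ c) (+-mono-≤ (*-monoʳ-≤ (t * t) wide-total) (*-monoʳ-≤ (t * t) tall-total)) ⟩
    τ * τ * onesℕ n (contract t A) + (t * t * (n * R) + t * t * (n * R)) ∎
    where
    c w w′ : ℕ → ℕ → ℕ
    c  I J = 𝟙 (contract t A I J)
    w  I J = 𝟙 (wide t τ A I J)
    w′ I J = 𝟙 (wide t τ (transpose A) J I)
    ∑∑ : (ℕ → ℕ → ℕ) → ℕ
    ∑∑ f = ∑[ I < n ] (∑[ J < n ] f I J)
    ∑∑-+ : ∀ f g → ∑∑ (λ I J → f I J + g I J) ≡ ∑∑ f + ∑∑ g
    ∑∑-+ f g = trans (∑-cong n (λ I → ∑-+ n (f I) (g I))) (∑-+ n _ _)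
    ∑∑-* : ∀ a f → ∑∑ (λ I J → a * f I J) ≡ a * ∑∑ f
    ∑∑-* a f = trans (∑-cong n (λ I → ∑-*ˡ n a (f I))) (∑-*ˡ n a _)
    distribute : ∑∑ (λ I J → τ * τ * c I J + (t * t * w I J + t * t * w′ I J)) ≡
                 τ * τ * ∑∑ c + (t * t * ∑∑ w + t * t * ∑∑ w′)
    distribute =
      trans (∑∑-+ _ _) (cong₂ _+_ (∑∑-* (τ * τ) c)
        (trans (∑∑-+ _ _) (cong₂ _+_ (∑∑-* (t * t) w) (∑∑-* (t * t) w′))))
    wide-total : ∑∑ w ≤ n * R
    wide-total = ≤-trans (≤-reflexive (∑-swap n n w))
      (≤-trans (∑-mono-≤ n (λ J _ → wide-few pq qp t strip-p A avoids n J)) (≤-reflexive (∑-const n R)))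
    tall-total : ∑∑ w′ ≤ n * R
    tall-total = ≤-trans
      (∑-mono-≤ n (λ I _ → wide-few qp pq t strip-q (transpose A)
        (λ e → avoids (transpose-Emb qp A e)) n I))
      (≤-reflexive (∑-const n R))

  power-bound : ∀ h A → ¬ Emb p A → onesℕ (t ^ h) A ≤ 4 * R * t * t ^ h
  power-bound zero A avoids = begin
    𝟙 (A 0 0) + 0 + 0   ≡⟨ trans (+-identityʳ _) (+-identityʳ _) ⟩
    𝟙 (A 0 0)           ≤⟨ 𝟙≤1 (A 0 0) ⟩
    1                   ≤⟨ *-mono-≤ {1} {4 * R * t} {1} {1}
                             (*-mono-≤ {1} {4 * R} (≤-trans 0<R (m≤m+n R _)) 0<t) ≤-refl ⟩
    4 * R * t * 1       ∎
  power-bound (suc h) A avoids = begin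
    onesℕ (t * t ^ h) A
      ≡⟨ cong (λ n → onesℕ n A) (*-comm t (t ^ h)) ⟩
    onesℕ (t ^ h * t) A
      ≤⟨ recursion (t ^ h) A avoids ⟩
    τ * τ * onesℕ (t ^ h) (contract t A) + (t * t * (t ^ h * R) + t * t * (t ^ h * R))
      ≤⟨ +-monoˡ-≤ _ (*-monoʳ-≤ (τ * τ)
           (power-bound h (contract t A) (λ e → avoids (contract-Emb pq qp t A e)))) ⟩
    τ * τ * (4 * R * t * t ^ h) + (t * t * (t ^ h * R) + t * t * (t ^ h * R))
      -- Since t = 2 τ², the contraction contributes half of the claimed bound, and the wide and
      -- tall blocks the other half; this is why the coefficient is 4 R t.
      ≡⟨ balance τ R (t ^ h) ⟩
    4 * R * t * (t * t ^ h) ∎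
    where
    balance : ∀ τ R n →
      τ * τ * (4 * R * (2 * τ * τ) * n) +
        (2 * τ * τ * (2 * τ * τ) * (n * R) + 2 * τ * τ * (2 * τ * τ) * (n * R)) ≡
      4 * R * (2 * τ * τ) * (2 * τ * τ * n)
    balance = solve-∀

  2≤t : 2 ≤ t
  2≤t = *-mono-≤ (*-mono-≤ {2} ≤-refl 0<τ) 0<τ

  -- Induction on `n`: once the power is too small, one more factor t ≥ 2 makes it large enough.
  power-above : ∀ n → ∃[ h ] (suc n ≤ t ^ h × t ^ h ≤ suc n * t)
  power-above zero = 0 , ≤-refl , ≤-trans 0<t (m≤m+n t 0)
  power-above (suc n) with power-above n
  ... | h , n<t^h , t^h≤ with suc (suc n) ≤? t ^ h
  ...   | yes le = h , le , ≤-trans t^h≤ (m≤n+m (suc n * t) t)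
  ...   | no  gt = suc h , (begin
    2 + n               ≤⟨ m≤m+n (2 + n) n ⟩
    2 + n + n           ≡⟨ double n ⟩
    2 * suc n           ≤⟨ *-mono-≤ 2≤t n<t^h ⟩
    t * t ^ h           ∎) , (begin
    t * t ^ h           ≡⟨ *-comm t (t ^ h) ⟩
    t ^ h * t           ≤⟨ *-monoˡ-≤ t (<⇒≤ (≰⇒> gt)) ⟩
    suc (suc n) * t     ∎)
    where
    double : ∀ n → 2 + n + n ≡ 2 * suc n
    double = solve-∀

  -- `A` is defined on all of ℕ, so its corner of side `n` lies in a corner of side `t ^ h` of the
  -- same avoiding matrix. Rounding up costs one more factor `t`.
  linear-bound : ∀ n A → ¬ Emb p A → onesℕ n A ≤ 4 * R * (t * t) * n
  linear-bound zero    A avoids = z≤n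
  linear-bound (suc n) A avoids with power-above n
  ... | h , n<t^h , t^h≤ = begin
    onesℕ (suc n) A
      ≤⟨ ≤-trans (∑-mono-≤ (suc n) (λ i _ → ∑-≤-length (λ j → 𝟙 (A i j)) n<t^h))
                 (∑-≤-length (λ i → ∑[ j < t ^ h ] 𝟙 (A i j)) n<t^h) ⟩
    onesℕ (t ^ h) A
      ≤⟨ power-bound h A avoids ⟩
    4 * R * t * t ^ h
      ≤⟨ *-monoʳ-≤ (4 * R * t) t^h≤ ⟩
    4 * R * t * (suc n * t)
      ≡⟨ regroup R t (suc n) ⟩
    4 * R * (t * t) * suc n ∎
    where
    regroup : ∀ r t n → 4 * r * t * (n * t) ≡ 4 * r * (t * t) * n
    regroup = solve-∀

-- Repetition-free permutation matrices

≤-nth : ∀ φ n i → i ≤ nth φ n i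
≤-nth φ n zero    = z≤n
≤-nth φ n (suc i) = ≤-<-trans (≤-nth φ n i) (nth-mono φ n (n<1+n i))

⊖-cross : ∀ x x′ a a′ → x + a′ ≡ x′ + a → a′ ⊖ a ≡ x′ ⊖ x
⊖-cross x x′ a a′ eq = begin
  a′ ⊖ a                ≡⟨ sym (ℤ.+-cancelˡ-⊖ x a′ a) ⟩
  (x + a′) ⊖ (x + a)    ≡⟨ cong₂ _⊖_ (trans eq (+-comm x′ a)) (+-comm x a) ⟩
  (a + x′) ⊖ (a + x)    ≡⟨ ℤ.+-cancelˡ-⊖ a x′ x ⟩
  x′ ⊖ x                ∎
  where open ≡-Reasoning

module _ {k : ℕ} (p : Fin k → Fin k) (n d x x′ : ℕ) where

  repeatedAt : ℕ → Bool
  repeatedAt j = (j + suc d <ᵇ k) ∧ (x + extend p (j + suc d) ≡ᵇ x′ + extend p j)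

  repeatedAt⇒ : ∀ j → repeatedAt j ≡ true →
    j + suc d < k × x + extend p (j + suc d) ≡ x′ + extend p j
  repeatedAt⇒ j h =
    let bound , eq = ∧-true (j + suc d <ᵇ k) h
    in <ᵇ≡⇒< (j + suc d) k bound , ≡ᵇ⇒≡ _ _ (≡⇒T eq)

  -- Makes every permutation matrix admissible with r = k, as needed when k ≤ s. The enumerated
  -- columns increase strictly, so a further one after `k` of them would be at least `k`.
  repetitions≤k : count n repeatedAt ≤ k
  repetitions≤k = ≮⇒≥ λ k<c →
    let j+d<k , _ = repeatedAt⇒ _ (nth-true repeatedAt n k<c)
    in <⇒≱ (≤-<-trans (m≤m+n _ (suc d)) j+d<k) (≤-nth repeatedAt n k)

  -- Leaving the entries and the order of coordinates abstract covers `P` read by columns and by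
  -- rows alike.
  module _ {r : ℕ} (P : BMat k k) (free : RepetitionFree r P) (entry : Fin k → Entry k)
    (one : ∀ j → P (proj₁ (entry j)) (proj₂ (entry j)) ≡ true)
    (entry-injective : ∀ {i j} → entry i ≡ entry j → i ≡ j)
    (vector : ℤ → ℤ → ℤ × ℤ)
    (dist-entry : ∀ i j → dist (entry i) (entry j) ≡
                          vector (toℕ (p j) ⊖ toℕ (p i)) (toℕ j ⊖ toℕ i)) where

    repetitions≤r : count n repeatedAt ≤ r
    repetitions≤r = ≮⇒≥ λ r<c → free (vector (x′ ⊖ x) (suc d ⊖ 0)) (repeated (<⇒≤ r<c))
      where
      module _ (r≤c : r ≤ count n repeatedAt) where
        position : Fin r → ℕ
        position i = nth repeatedAt n (toℕ i)
        valid : ∀ i → position i + suc d < k ×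
                      x + extend p (position i + suc d) ≡ x′ + extend p (position i)
        valid i = repeatedAt⇒ (position i)
                    (nth-true repeatedAt n (<-≤-trans (Fin.toℕ<n i) r≤c))
        position< : ∀ i → position i < k
        position< i = ≤-<-trans (m≤m+n _ (suc d)) (proj₁ (valid i))
        first second : Fin r → Fin k
        first  i = fromℕ< (position< i)
        second i = fromℕ< (proj₁ (valid i))
        toℕ-first : ∀ i → toℕ (first i) ≡ position i
        toℕ-first i = Fin.toℕ-fromℕ< (position< i)
        toℕ-second : ∀ i → toℕ (second i) ≡ position i + suc d
        toℕ-second i = Fin.toℕ-fromℕ< (proj₁ (valid i))

        columns : ∀ i → toℕ (second i) ⊖ toℕ (first i) ≡ suc d ⊖ 0
        columns i = ⊖-cross 0 (suc d) _ _
          (trans (toℕ-second i) (trans (+-comm (position i) (suc d))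
            (cong (suc d +_) (sym (toℕ-first i)))))

        rows : ∀ i → toℕ (p (second i)) ⊖ toℕ (p (first i)) ≡ x′ ⊖ x
        rows i = ⊖-cross x x′ _ _ (begin
          x + toℕ (p (second i))           ≡⟨ cong (x +_) (sym (extend-toℕ p (second i))) ⟩
          x + extend p (toℕ (second i))    ≡⟨ cong (λ j → x + extend p j) (toℕ-second i) ⟩
          x + extend p (position i + suc d) ≡⟨ proj₂ (valid i) ⟩
          x′ + extend p (position i)       ≡⟨ cong (λ j → x′ + extend p j) (sym (toℕ-first i)) ⟩
          x′ + extend p (toℕ (first i))    ≡⟨ cong (x′ +_) (extend-toℕ p (first i)) ⟩
          x′ + toℕ (p (first i))           ∎)
          where open ≡-Reasoning

        position-injective : ∀ {i j} → position i ≡ position j → i ≡ j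
        position-injective {i} {j} eq with Fin.<-cmp i j
        ... | tri< i<j _ _ = contradiction eq (<⇒≢ (nth-mono repeatedAt n i<j))
        ... | tri≈ _ i≡j _ = i≡j
        ... | tri> _ _ i>j = contradiction (sym eq) (<⇒≢ (nth-mono repeatedAt n i>j))

        repeated : Repeated r P (vector (x′ ⊖ x) (suc d ⊖ 0))
        repeated =
          (λ i → entry (first i) , entry (second i)) ,
          (λ {i} {j} eq → position-injective (trans (sym (toℕ-first i))
            (trans (cong toℕ (entry-injective (cong proj₁ eq))) (toℕ-first j)))) ,
          (λ i → one (first i) , one (second i) ,
            (λ eq → <⇒≢ (m<m+n (position i) z<s) (trans (sym (toℕ-first i))
              (trans (cong toℕ (entry-injective eq)) (toℕ-second i)))) ,
            trans (dist-entry (first i) (second i)) (cong₂ vector (rows i) (columns i)))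

-- From finite matrices to matrices on ℕ

∑-tabulate : ∀ {n} {f : Fin n → ℕ} (F : ℕ → ℕ) → (∀ i → f i ≡ F (toℕ i)) →
             sum (map f (allFin n)) ≡ ∑ n F
∑-tabulate {n} {f} F eq = trans (cong sum (map-tabulate id f)) (go F eq)
  where
  go : ∀ {n} {f : Fin n → ℕ} (F : ℕ → ℕ) → (∀ i → f i ≡ F (toℕ i)) → sum (tabulate f) ≡ ∑ n F
  go {zero}  F eq = refl
  go {suc n} F eq = cong₂ _+_ (eq zero) (go (F ∘ suc) (eq ∘ suc))

module Padding {n : ℕ} (M : BMat n n) where

  pad : ℕ → ℕ → Bool
  pad i j with i <? n | j <? n
  ... | yes i<n | yes j<n = M (fromℕ< i<n) (fromℕ< j<n)
  ... | _       | _       = false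

  pad-toℕ : ∀ i j → pad (toℕ i) (toℕ j) ≡ M i j
  pad-toℕ i j with toℕ i <? n | toℕ j <? n
  ... | yes i<n | yes j<n = cong₂ M (Fin.fromℕ<-toℕ i i<n) (Fin.fromℕ<-toℕ j j<n)
  ... | yes _   | no  j≮n = contradiction (Fin.toℕ<n j) j≮n
  ... | no  i≮n | _       = contradiction (Fin.toℕ<n i) i≮n

  pad-support : ∀ i j → pad i j ≡ true → i < n × j < n
  pad-support i j h with i <? n | j <? n
  pad-support i j h  | yes i<n | yes j<n = i<n , j<n
  pad-support i j () | yes _   | no _
  pad-support i j () | no _    | _

  ones-pad : ones M ≡ onesℕ n pad
  ones-pad = ∑-tabulate _ (λ i → ∑-tabulate _ (λ j → cong 𝟙 (sym (pad-toℕ i j))))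

  pad-contains : ∀ {k} {p q : Fin k → Fin k} → (∀ i → p (q i) ≡ i) → (P : BMat k k) →
    (∀ i j → P i j ≡ true → i ≡ p j) → Emb p pad → Contains M P
  pad-contains {k} {p} {q} pq P P⇒p (a , b , a-mono , b-mono , hit) = f , g ,
    (λ i j i<j → subst₂ _<_ (sym (toℕ-f i)) (sym (toℕ-f j)) (a-mono i j i<j)) ,
    (λ i j i<j → subst₂ _<_ (sym (toℕ-g i)) (sym (toℕ-g j)) (b-mono i j i<j)) ,
    (λ i j Pij → trans (sym (pad-toℕ (f i) (g j))) (trans (cong₂ pad (toℕ-f i) (toℕ-g j))
      (subst (λ i′ → pad (a i′) (b j) ≡ true) (sym (P⇒p i j Pij)) (hit j))))
    where
    a<n : ∀ i → a i < n
    -- Row `i` of the pattern has its one in column `q i`, and ones of `pad` occur only in range.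
    a<n i = subst (λ i′ → a i′ < n) (pq i) (proj₁ (pad-support _ _ (hit (q i))))
    b<n : ∀ j → b j < n
    b<n j = proj₂ (pad-support _ _ (hit j))
    f g : Fin k → Fin n
    f i = fromℕ< (a<n i)
    g j = fromℕ< (b<n j)
    toℕ-f : ∀ i → toℕ (f i) ≡ a i
    toℕ-f i = Fin.toℕ-fromℕ< (a<n i)
    toℕ-g : ∀ j → toℕ (g j) ≡ b j
    toℕ-g j = Fin.toℕ-fromℕ< (b<n j)

-- Constants and the final bound

constant-≤ : ∀ {k s L} → 0 < s → 0 < L → k ≤ 2 ^ L → let t = 2 * 2 ^ (4 + L) * 2 ^ (4 + L) in
  4 * (k + k) ^ (64 * s * (6 + L)) * (t * t) ≤ 2 ^ (920 * s * L * L)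
constant-≤ {k} {suc a} {suc b} _ _ k≤2^L = begin
  4 * (k + k) ^ e * (t * t)
    ≤⟨ *-mono-≤ (*-monoʳ-≤ 4 (^-monoˡ-≤ e 2k≤)) ≤-refl ⟩
  4 * (2 ^ (1 + L)) ^ e * (t * t)
    ≡⟨ cong₂ (λ u v → 4 * u * (v * v)) (^-*-assoc 2 (1 + L) e) t≡ ⟩
  2 ^ 2 * 2 ^ ((1 + L) * e) * (2 ^ m * 2 ^ m)
    ≡⟨ cong₂ _*_ (sym (^-distribˡ-+-* 2 2 ((1 + L) * e))) (sym (^-distribˡ-+-* 2 m m)) ⟩
  2 ^ (2 + (1 + L) * e) * 2 ^ (m + m)
    ≡⟨ sym (^-distribˡ-+-* 2 (2 + (1 + L) * e) (m + m)) ⟩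
  2 ^ (2 + (1 + L) * e + (m + m))
    ≤⟨ ^-monoʳ-≤ 2 {2 + (1 + L) * e + (m + m)} {920 * s * L * L}
         (≤-trans (m≤m+n _ rest) (≤-reflexive (exponent a b))) ⟩
  2 ^ (920 * s * L * L) ∎
  where
  open ≤-Reasoning
  s = suc a
  L = suc b
  e = 64 * s * (6 + L)
  t = 2 * 2 ^ (4 + L) * 2 ^ (4 + L)
  m = 1 + (4 + L) + (4 + L)
  2k≤ : k + k ≤ 2 ^ (1 + L)
  2k≤ = ≤-trans (+-mono-≤ k≤2^L k≤2^L) (≤-reflexive (cong (2 ^ L +_) (sym (+-identityʳ (2 ^ L)))))
  t≡ : t ≡ 2 ^ m
  t≡ = sym (^-distribˡ-+-* 2 (1 + (4 + L)) (4 + L))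
  -- The difference of the two exponents in terms of s - 1 and L - 1. The smaller exponent equals
  -- 920 at s = L = 1, so no constant term remains.
  rest = 24 * a + 1260 * b + 856 * (b * b) + a * (1264 * b + 856 * (b * b))
  exponent : ∀ a b →
    2 + (1 + suc b) * (64 * suc a * (6 + suc b)) +
      (1 + (4 + suc b) + (4 + suc b) + (1 + (4 + suc b) + (4 + suc b)))
      + (24 * a + 1260 * b + 856 * (b * b) + a * (1264 * b + 856 * (b * b)))
    ≡ 920 * suc a * suc b * suc b
  exponent = solve-∀

-- With `s` about r^(1/3) k^(2/3) and `L` about log k the exponent has the required order. Strips
-- are needed for `q` too, as tall blocks are wide blocks of the transpose.
permutation-bound : ∀ {k r s L} {p q : Fin k → Fin k} → (∀ i → p (q i) ≡ i) → (∀ j → q (p j) ≡ j) →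
  FewRepetitions k r (extend p) → FewRepetitions k r (extend q) →
  0 < k → 0 < s → 0 < L → s ≤ k → k ≤ 2 ^ L → r * k ^ 2 ≤ s ^ 3 →
  ∀ n A → ¬ Emb p A → onesℕ n A ≤ 2 ^ (920 * s * L * L) * n
permutation-bound {k} {s = s} {L} pq qp few-p few-q 0<k 0<s 0<L s≤k k≤2^L rk²≤s³ n A avoids =
  ≤-trans
    (BlockRecursion.linear-bound pq qp {2 ^ (4 + L)} {(k + k) ^ (64 * s * (6 + L))}
      (m^n>0 2 (4 + L)) (m^n>0 (k + k) (64 * s * (6 + L)))
      (strip-Emb {L = L} pq qp few-p 0<k 0<s s≤k k≤2^L rk²≤s³)
      (strip-Emb {L = L} qp pq few-q 0<k 0<s s≤k k≤2^L rk²≤s³) n A avoids)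
    (*-monoˡ-≤ n (constant-≤ {k} {s} {L} 0<s 0<L k≤2^L))
  where
  instance
    2k≢0 : NonZero (k + k)
    2k≢0 = >-nonZero (≤-trans 0<k (m≤m+n k k))

-- Removes `s ≤ k`: if k ≤ s, the choice s = r = k satisfies r k² = s³, and the resulting exponent
-- is no larger.
permutation-bound′ : ∀ {k r s L} {p q : Fin k → Fin k} → (∀ i → p (q i) ≡ i) → (∀ j → q (p j) ≡ j) →
  FewRepetitions k r (extend p) → FewRepetitions k r (extend q) →
  0 < k → 0 < s → 0 < L → k ≤ 2 ^ L → r * k ^ 2 ≤ s ^ 3 →
  ∀ n A → ¬ Emb p A → onesℕ n A ≤ 2 ^ (920 * s * L * L) * n
permutation-bound′ {k} {s = s} {L} {p} {q} pq qp few-p few-q 0<k 0<s 0<L k≤2^L rk²≤s³ n A avoids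
  with ≤-total s k
... | inj₁ s≤k = permutation-bound pq qp few-p few-q 0<k 0<s 0<L s≤k k≤2^L rk²≤s³ n A avoids
... | inj₂ k≤s = ≤-trans
  (permutation-bound {r = k} pq qp (repetitions≤k p) (repetitions≤k q)
    0<k 0<k 0<L ≤-refl k≤2^L ≤-refl n A avoids)
  (*-monoˡ-≤ n (^-monoʳ-≤ 2 (*-monoˡ-≤ L (*-monoˡ-≤ L (*-monoʳ-≤ 920 k≤s)))))

-- The bound on the limit is stated as: for every d the ratio is eventually at most K + 1 / (d + 1),
-- multiplied out.
clear-denominator : ∀ o K n c → o ≤ K * n → o * c ≤ (K * c + 1) * n
clear-denominator o K n c o≤ = begin
  o * c              ≤⟨ *-monoˡ-≤ c o≤ ⟩
  K * n * c          ≡⟨ regroup K n c ⟩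
  K * c * n          ≤⟨ *-monoˡ-≤ n (m≤m+n (K * c) 1) ⟩
  (K * c + 1) * n    ∎
  where
  open ≤-Reasoning
  regroup : ∀ a b c → a * b * c ≡ a * c * b
  regroup = solve-∀

theorem1p1 : ∃[ C ] (0 < C ×
    (∀ (k r : ℕ) → 9 ≤ k → 3 ≤ r → (P : BMat k k) → IsPermutationMatrix P → RepetitionFree r P →
    ∀ (s L : ℕ) → r * k ^ 2 ≤ s ^ 3 → k ≤ 2 ^ L →
    ∀ (d : ℕ) → ∃[ N ] (∀ (n : ℕ) → N ≤ n → (M : BMat n n) → Avoids M P →
    ones M * suc d ≤ (2 ^ (C * s * L * L) * suc d + 1) * n)))
theorem1p1 = 920 , z<s , λ k r 9≤k 3≤r P (rows , columns) free s L rk²≤s³ k≤2^L d →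
  0 , λ n _ M avoids →
  let open Padding M
      p = λ j → proj₁ (columns j)
      q = λ i → proj₁ (rows i)
      P-p : ∀ j → P (p j) j ≡ true
      P-p j = proj₁ (proj₂ (columns j))
      P-q : ∀ i → P i (q i) ≡ true
      P-q i = proj₁ (proj₂ (rows i))
      pq : ∀ i → p (q i) ≡ i
      pq i = sym (proj₂ (proj₂ (columns (q i))) i (P-q i))
      qp : ∀ j → q (p j) ≡ j
      qp j = sym (proj₂ (proj₂ (rows (p j))) j (P-p j))
      few-p : FewRepetitions k r (extend p)
      few-p n d x x′ = repetitions≤r p n d x x′ P free (λ j → p j , j) P-p (cong proj₂) _,_ (λ _ _ → refl)
      -- Reading `P` by rows exchanges the coordinates of the distance vector.
      few-q : FewRepetitions k r (extend q)
      few-q n d x x′ = repetitions≤r q n d x x′ P free (λ i → i , q i) P-q (cong proj₁)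
                         (λ a b → b , a) (λ _ _ → refl)
      avoids′ : ¬ Emb p pad
      avoids′ e = avoids (pad-contains pq P (λ i j Pij → proj₂ (proj₂ (columns j)) i Pij) e)
      0<k = ≤-trans z<s 9≤k
      0<s : 0 < s
      0<s = n≢0⇒n>0 λ { refl → <⇒≱ (*-mono-≤ {1} {r} {1} {k ^ 2} (≤-trans z<s 3≤r)
                                  (*-mono-≤ 0<k (*-mono-≤ 0<k (≤-refl {1})))) rk²≤s³ }
      0<L : 0 < L
      0<L = n≢0⇒n>0 λ { refl → <⇒≱ (≤-trans (s≤s (s≤s z≤n)) 9≤k) k≤2^L }
  in clear-denominator (ones M) (2 ^ (920 * s * L * L)) n (suc d)
       (≤-trans (≤-reflexive ones-pad)
         (permutation-bound′ pq qp few-p few-q 0<k 0<s 0<L k≤2^L rk²≤s³ n pad avoids′))
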